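{- Let $d:E\to\mathbb{Z}_{>0}$ be a positive integer edge cost, $M$ a positive integer, and $e_0\in E$ an edge with $d(e_0)$ even. Define $d_1:E\to\mathbb{Z}_+$ by $d_1(e_0)=d(e_0)-1$ and $d_1(e)=d(e)$ for $e\neq e_0$. If $p\in\mathbb{G}^n$ is a minimizer of $h_{d,M}$, then there exists a minimizer $q\in\mathbb{G}^n$ of $h_{d_1,M}$ with $\|p-q\|\le 2$.
   Context: Network: simple undirected graph $(V,E)$, $V=\{1,\dots,n\}$, terminals $S=\{1,\dots,k\}\subseteq V$, $k\ge3$, no edge between two terminals, node capacities $c:V\setminus S\to\mathbb{Z}_+$. Grid: the infinite $k$-star $\mathbb{T}$ is $\mathbb{R}_+\times\{1,\dots,k\}$ with all $(0,s)$ identified to a point $0$; $(x,s)$ is also written $x$; $\mathrm{dist}((x,s),(x',s'))=|x-x'|$ if $s=s'$, $x+x'$ otherwise. $x$ is integral if $\mathrm{dist}(x,0)\in\mathbb{Z}$, proper half-integral if $2\mathrm{dist}(x,0)\in\mathbb{Z}$ but $\mathrm{dist}(x,0)\notin\mathbb{Z}$. $\mathbb{G}\subseteq\mathbb{T}\times\mathbb{R}$ is the set of $(x,y)$ with $x,y$ both integral or both proper half-integral. For $(x,y),(x',y')$ put $\|(x,y)-(x',y')\|=\mathrm{dist}(x,x')+|y-y'|$, and for $p,q\in\mathbb{G}^n$, $\|p-q\|=\max_i\|p_i-q_i\|$. Potential for $d$ and $M$: $(x,y)=((x_1,y_1),\dots,(x_n,y_n))\in\mathbb{G}^n$ with $\mathrm{dist}(x_i,x_j)-y_i-y_j\le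 2d(ij)$ for all $ij\in E$, $(x_s,y_s)=((M,s),0)$ for $s\in S$, $y_i\ge0$ and $\mathrm{dist}(0,x_i)\le M$ for all $i\in V$. $h_{d,M}(x,y)=\sum_{i\in V\setminus S}c_iy_i$ if $(x,y)$ is a potential for $d$ and $M$, and $+\infty$ otherwise. -}

module Defs where

open import Algebra.Properties.CommutativeMonoid.Sum using (sum)
open import Data.Bool using (Bool; false; T; if_then_else_)
open import Data.Bool.Properties using (T?)
open import Data.Fin as Fin using (Fin; _↑ˡ_; _↑ʳ_)
import Data.Fin.Properties as Fin
open import Data.Integer as ℤ using (ℤ; +_)
open import Data.Nat as ℕ using (ℕ)
open import Data.Product using (∃-syntax; _×_; _,_)
open import Data.Rational using (ℚ; 0ℚ; _+_; _-_; _*_; _⊔_; ∣_∣; _≤_; _≟_; _≤?_)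
open import Data.Rational.Literals using (fromℤ)
open import Data.Rational.Properties using (+-0-commutativeMonoid; nonNegative⁻¹)
open import Data.Sum using (_⊎_)
open import Data.Vec.Functional using (Vector; foldr)
open import Relation.Binary using (Decidable; DecidableEquality)
open import Relation.Binary.PropositionalEquality using (_≡_; refl; cong)
open import Relation.Nullary using (Dec; yes; no; ¬_; does)
open import Relation.Nullary.Negation using (contradiction-irr)
open import Relation.Nullary.Decidable using (map′; _×-dec_; _⊎-dec_)
open import Relation.Nullary.Construct.Add.Supremum using (_⁺; ⊤⁺; [_])
open import Relation.Binary.Construct.Add.Supremum.NonStrict _≤_ using (_≤⁺_)

-- Networks.  The vertex set is Fin (k + m), of size n = k + m: the terminals
-- are s ↑ˡ m (the first k vertices), the non-terminals are k ↑ʳ j.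

record Network (k m : ℕ) : Set where
  field
    adj          : Fin (k ℕ.+ m) → Fin (k ℕ.+ m) → Bool
    adj-sym      : ∀ i j → adj i j ≡ adj j i
    adj-irrefl   : ∀ i → adj i i ≡ false
    no-terminals : ∀ (s t : Fin k) → adj (s ↑ˡ m) (t ↑ˡ m) ≡ false
    capacity     : Fin m → ℕ

-- An undirected edge is listed once, with its smaller endpoint as source.
-- The proof fields are irrelevant, so an edge is determined by its endpoints.

record Edge {k m : ℕ} (N : Network k m) : Set where
  constructor edge
  open Network N
  field
    source    : Fin (k ℕ.+ m)
    target    : Fin (k ℕ.+ m)
    .ordered  : source Fin.< target
    .adjacent : T (adj source target)

open Edge public

_≟ᴱ_ : ∀ {k m} {N : Network k m} → DecidableEquality (Edge N)
edge i j _ _ ≟ᴱ edge i′ j′ _ _ =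
  map′ (λ { (refl , refl) → refl }) (λ e≡ → cong source e≡ , cong target e≡)
       ((i Fin.≟ i′) ×-dec (j Fin.≟ j′))

Cost : ∀ {k m} → Network k m → Set
Cost N = Edge N → ℕ

decreaseAt : ∀ {k m} {N : Network k m} → Edge N → Cost N → Cost N
decreaseAt e₀ d e = if does (e ≟ᴱ e₀) then d e ℕ.∸ 1 else d e

-- Points (radius , leg) of the star with k legs.  Rational radii suffice, as
-- all grid points have half-integral coordinates.  The identification of the
-- points (0 , s) is the equivalence relation _≈_, which dist and everything
-- below respect; the radius is the distance to the centre.

record Star (k : ℕ) : Set where
  constructor star
  field
    radius : ℚ
    nonneg : 0ℚ ≤ radius
    leg    : Fin k

open Star public

_≈_ : ∀ {k} → Star k → Star k → Set
u ≈ v = radius u ≡ radius v × (radius u ≡ 0ℚ ⊎ leg u ≡ leg v)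

_≈?_ : ∀ {k} → Decidable (_≈_ {k})
u ≈? v = (radius u ≟ radius v) ×-dec ((radius u ≟ 0ℚ) ⊎-dec (leg u Fin.≟ leg v))

dist : ∀ {k} → Star k → Star k → ℚ
dist u v = if does (leg u Fin.≟ leg v)
           then ∣ radius u - radius v ∣
           else radius u + radius v

fromℕ : ℕ → ℚ
fromℕ a = fromℤ (+ a)

onLeg : ∀ {k} → ℕ → Fin k → Star k
onLeg a s = star (fromℕ a) (nonNegative⁻¹ (fromℕ a)) s

Integral : ℚ → Set
Integral r = ∃[ z ] r ≡ fromℤ z

ProperHalfIntegral : ℚ → Set
ProperHalfIntegral r = Integral (fromℕ 2 * r) × ¬ Integral r

record Grid (k : ℕ) : Set where
  constructor grid
  field
    x      : Star k
    y      : ℚ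
    parity : (Integral (radius x) × Integral y)
           ⊎ (ProperHalfIntegral (radius x) × ProperHalfIntegral y)

open Grid public

gridDist : ∀ {k} → Grid k → Grid k → ℚ
gridDist u v = dist (x u) (x v) + ∣ y u - y v ∣

-- The maximum over all coordinates; since distances are nonnegative, the
-- initial value 0 does not affect it.
distance : ∀ {k n} → Vector (Grid k) n → Vector (Grid k) n → ℚ
distance p q = foldr _⊔_ 0ℚ (λ i → gridDist (p i) (q i))

module _ {k m : ℕ} (N : Network k m) (d : Cost N) (M : ℕ) where
  open Network N

  EdgeBound : Vector (Grid k) (k ℕ.+ m) → Edge N → Set
  EdgeBound p e =
    dist (x (p (source e))) (x (p (target e))) - y (p (source e)) - y (p (target e))
      ≤ fromℕ 2 * fromℕ (d e)

  record IsPotential (p : Vector (Grid k) (k ℕ.+ m)) : Set where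
    field
      edge-bound : ∀ e → EdgeBound p e
      terminal   : ∀ s → x (p (s ↑ˡ m)) ≈ onLeg M s × y (p (s ↑ˡ m)) ≡ 0ℚ
      y-nonneg   : ∀ i → 0ℚ ≤ y (p i)
      within     : ∀ i → radius (x (p i)) ≤ fromℕ M

  private
    EdgeBoundAt : Vector (Grid k) (k ℕ.+ m) → Fin (k ℕ.+ m) → Fin (k ℕ.+ m) → Set
    EdgeBoundAt p i j =
      .(i<j : i Fin.< j) .(i~j : T (adj i j)) → EdgeBound p (edge i j i<j i~j)

    edgeBoundAt? : ∀ p i j → Dec (EdgeBoundAt p i j)
    edgeBoundAt? p i j with i Fin.<? j | T? (adj i j)
    ... | no i≮j  | _       = yes λ i<j _ → contradiction-irr i<j i≮j
    ... | yes _   | no i≁j  = yes λ _ i~j → contradiction-irr i~j i≁j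
    ... | yes i<j | yes i~j = map′ (λ b _ _ → b) (λ f → f i<j i~j) (_ ≤? _)

    edgeBounds? : ∀ p → Dec (∀ e → EdgeBound p e)
    edgeBounds? p =
      map′ {A = ∀ i j → EdgeBoundAt p i j}
           (λ { f (edge i j i<j i~j) → f i j i<j i~j })
           (λ f i j i<j i~j → f (edge i j i<j i~j))
           (Fin.all? λ i → Fin.all? λ j → edgeBoundAt? p i j)

  isPotential? : ∀ p → Dec (IsPotential p)
  isPotential? p =
    map′ (λ (a , b , c , e) → record
            { edge-bound = a ; terminal = b ; y-nonneg = c ; within = e })
         (λ P → let open IsPotential P in edge-bound , terminal , y-nonneg , within)
         (edgeBounds? p
          ×-dec Fin.all? (λ s → (x (p (s ↑ˡ m)) ≈? onLeg M s) ×-dec (y (p (s ↑ˡ m)) ≟ 0ℚ))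
          ×-dec Fin.all? (λ i → 0ℚ ≤? y (p i))
          ×-dec Fin.all? (λ i → radius (x (p i)) ≤? fromℕ M))

  h : Vector (Grid k) (k ℕ.+ m) → ℚ ⁺
  h p = if does (isPotential? p)
        then [ sum +-0-commutativeMonoid (λ j → fromℕ (capacity j) * y (p (k ↑ʳ j))) ]
        else ⊤⁺

IsMinimizer : ∀ {A : Set} → (A → ℚ ⁺) → A → Set
IsMinimizer f p = ∀ q → f p ≤⁺ f q

{-# OPTIONS --safe #-}
module Submission where

-- In the coordinates hi = y + r and lo = y − r the grid is an integer lattice
-- along any line through two legs, and edge bounds become inequalities on sums
-- of two coordinates.  Let u be the given minimizer and v any potential for
-- the decreased cost.  Replace each coordinate p of u by p + ψ (q − p), where
-- q is the same coordinate of v and ψ is odd with steps of height 0 or 1 and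
-- |ψ| ≤ 2; replace q by q − ψ (q − p).  Inequalities valid at both u and v
-- survive, and the sum of the two objectives is unchanged, so minimality of u
-- shows that the first new point, at distance at most 2 from u, costs no more
-- than v.  Only the bound of e₀ may fail there, being stricter for v than for
-- u; placing the steps of ψ at a nearly tight coordinate of an end of e₀
-- prevents this.  Hence a minimum over the finite neighbourhood of u is global.

module HalfIntegralLattice where

  open import Defs
  open import Data.Bool using (true; false; if_then_else_)
  open import Data.Fin as Fin using (Fin; _↑ˡ_; _↑ʳ_; zero; suc; combine; remQuot; finToFun; funToFin)
  open import Data.Fin.Patterns using (0F; 1F; 2F; 3F; 4F)
  import Data.Fin.Properties as Fin
  open import Data.Integer as ℤ using (ℤ; +_; -[1+_]; 0ℤ; 1ℤ; +≤+; -≤+; _+_; _-_; -_; _≤_)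
  import Data.Integer.Properties as ℤ
  open import Data.Integer.Tactic.RingSolver using (solve; solve-∀)
  open import Data.List.Base using ([]; _∷_; allFin)
  import Data.List.Extrema as Extrema
  open import Data.List.Membership.Propositional.Properties using (∈-allFin)
  import Data.List.Relation.Unary.All as All
  open import Data.Nat as ℕ using (ℕ; zero; suc; _∸_)
  import Data.Nat.Properties as ℕ
  open import Data.Product using (_×_; _,_; proj₁; proj₂; ∃-syntax)
  open import Data.Rational as ℚ using (ℚ; 0ℚ; 1ℚ; ½; *≤*)
  open import Data.Rational.Literals using (fromℤ)
  import Data.Rational.Properties as ℚ
  open import Algebra.Properties.CommutativeMonoid.Sum ℚ.+-0-commutativeMonoid
    using (sum; ∑-distrib-+; sum-cong-≗)
  import Data.Rational.Unnormalised as ℚᵘ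
  import Data.Rational.Unnormalised.Properties as ℚᵘ
  open import Data.Sum using (_⊎_; inj₁; inj₂; [_,_]′)
  open import Data.Vec.Functional using (Vector; foldr)
  open import Function using (_∘_)
  open import Relation.Binary using (TotalOrder)
  open import Relation.Binary.Construct.Add.Supremum.NonStrict ℚ._≤_
    using (_≤⁺_; [_]; _≤⊤⁺; [≤]-injective; ≤⁺-isTotalOrder-≡)
  open import Relation.Binary.PropositionalEquality
  open import Relation.Nullary using (Dec; yes; no; does; contradiction; ¬_)
  open import Relation.Nullary.Construct.Add.Supremum using (_⁺; ⊤⁺; [_])
  open import Relation.Nullary.Decidable using (dec-true; dec-false; from-yes)

  -- Reduces a linear consequence to an identity for the ring solver.
  ≤-by : ∀ {a b c d} → a ≤ b → b - a ≡ d - c → c ≤ d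
  ≤-by a≤b eq = ℤ.0≤i-j⇒j≤i (subst (0ℤ ≤_) eq (ℤ.i≤j⇒0≤j-i a≤b))

  -- Odd staircases and the inequalities they preserve.

  record OddStaircase (f : ℤ → ℤ) : Set where
    field
      odd   : ∀ t → f (- t) ≡ - f t
      rise  : ∀ t → f t ≤ f (1ℤ + t)
      climb : ∀ t → f (1ℤ + t) ≤ 1ℤ + f t

    climb-+ : ∀ n t → f (+ n + t) ≤ + n + f t
    climb-+ zero    t = ℤ.≤-reflexive (trans (cong f (ℤ.+-identityˡ t)) (sym (ℤ.+-identityˡ (f t))))
    climb-+ (suc n) t = begin
      f (1ℤ + + n + t)   ≡⟨ cong f (ℤ.+-assoc 1ℤ (+ n) t) ⟩
      f (1ℤ + (+ n + t)) ≤⟨ climb (+ n + t) ⟩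
      1ℤ + f (+ n + t)   ≤⟨ ℤ.+-monoʳ-≤ 1ℤ (climb-+ n t) ⟩
      1ℤ + (+ n + f t)   ≡⟨ ℤ.+-assoc 1ℤ (+ n) (f t) ⟨
      1ℤ + + n + f t     ∎
      where open ℤ.≤-Reasoning

    rise-+ : ∀ n t → f t ≤ f (+ n + t)
    rise-+ zero    t = ℤ.≤-reflexive (cong f (sym (ℤ.+-identityˡ t)))
    rise-+ (suc n) t = begin
      f t                ≤⟨ rise-+ n t ⟩
      f (+ n + t)        ≤⟨ rise (+ n + t) ⟩
      f (1ℤ + (+ n + t)) ≡⟨ cong f (ℤ.+-assoc 1ℤ (+ n) t) ⟨
      f (1ℤ + + n + t)   ∎
      where open ℤ.≤-Reasoning

    mono : ∀ {s t} → s ≤ t → f s ≤ f t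
    mono {s} {t} s≤t = begin
      f s                   ≤⟨ rise-+ ℤ.∣ t - s ∣ s ⟩
      f (+ ℤ.∣ t - s ∣ + s) ≡⟨ cong (λ r → f (r + s)) (ℤ.0≤i⇒+∣i∣≡i (ℤ.i≤j⇒0≤j-i s≤t)) ⟩
      f (t - s + s)         ≡⟨ cong f (solve (t ∷ s ∷ [])) ⟩
      f t                   ∎
      where open ℤ.≤-Reasoning

    climb-≤ : ∀ n {s t} → s ≤ + n + t → f s ≤ + n + f t
    climb-≤ n {t = t} s≤n+t = ℤ.≤-trans (mono s≤n+t) (climb-+ n t)

    zero-fixed : f 0ℤ ≡ 0ℤ
    zero-fixed = self-opposite (odd 0ℤ)
      where
      self-opposite : ∀ {z} → z ≡ - z → z ≡ 0ℤ
      self-opposite {+ zero} _ = refl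

    -- The hypothesis places `- x` at most `T` above `y`, and a staircase climbs at most 1 per unit;
    -- oddness then turns `f (- x)` into `- f x`.
    preserves-≥0 : ∀ T {x y} → 0ℤ ≤ T → 0ℤ ≤ T + (x + y) → 0ℤ ≤ T + (f x + f y)
    preserves-≥0 (+ n) {x} {y} _ 0≤ =
      ≤-by (climb-≤ n {s = - x} (≤-by 0≤ (regroup (+ n) x y))) eq
      where
      regroup : ∀ n x y → n + (x + y) - 0ℤ ≡ n + y - - x
      regroup = solve-∀
      rearrange : ∀ n fx fy → n + fy - (- fx) ≡ n + (fx + fy) - 0ℤ
      rearrange = solve-∀
      eq : + n + f y - f (- x) ≡ + n + (f x + f y) - 0ℤ
      eq = trans (cong (λ z → + n + f y - z) (odd x)) (rearrange (+ n) (f x) (f y))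

    -- A staircase may be flat just after `- x` and lose the bound 2. Two unit steps starting at
    -- `- x` supply what is missing when `T` is 0 or 1; from `T = 2` on, two units of `T` pay for
    -- the bound and the rest for the climb.
    preserves-≥2 : ∀ T {x y} → 1ℤ + f (- x) ≤ f (1ℤ + - x) → + 2 + f (- x) ≤ f (+ 2 + - x) →
                   0ℤ ≤ T → + 2 ≤ T + (x + y) → + 2 ≤ T + (f x + f y)
    preserves-≥2 T {x} {y} step₁ step₂ 0≤T 2≤ = ≤-by (bound T 0≤T 2≤) eq
      where
      rearrange : ∀ t fx fy → t + fy - (+ 2 + - fx) ≡ t + (fx + fy) - + 2
      rearrange = solve-∀
      eq : T + f y - (+ 2 + f (- x)) ≡ T + (f x + f y) - + 2
      eq = trans (cong (λ z → T + f y - (+ 2 + z)) (odd x)) (rearrange T (f x) (f y))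
      bound : ∀ T → 0ℤ ≤ T → + 2 ≤ T + (x + y) → + 2 + f (- x) ≤ T + f y
      bound (+ 0) _ 2≤ = begin
        + 2 + f (- x)   ≤⟨ step₂ ⟩
        f (+ 2 + - x)   ≤⟨ mono (≤-by 2≤ (regroup₀ x y)) ⟩
        f y             ≡⟨ ℤ.+-identityˡ (f y) ⟨
        0ℤ + f y        ∎
        where
        open ℤ.≤-Reasoning
        regroup₀ : ∀ x y → 0ℤ + (x + y) - + 2 ≡ y - (+ 2 + - x)
        regroup₀ = solve-∀
      bound (+ 1) _ 2≤ = begin
        1ℤ + 1ℤ + f (- x)   ≡⟨ ℤ.+-assoc 1ℤ 1ℤ (f (- x)) ⟩
        1ℤ + (1ℤ + f (- x)) ≤⟨ ℤ.+-monoʳ-≤ 1ℤ step₁ ⟩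
        1ℤ + f (1ℤ + - x)   ≤⟨ ℤ.+-monoʳ-≤ 1ℤ (mono (≤-by 2≤ (regroup₁ x y))) ⟩
        1ℤ + f y            ∎
        where
        open ℤ.≤-Reasoning
        regroup₁ : ∀ x y → 1ℤ + (x + y) - + 2 ≡ y - (1ℤ + - x)
        regroup₁ = solve-∀
      bound (+ suc (suc n)) _ 2≤ = begin
        + 2 + f (- x)      ≤⟨ ℤ.+-monoʳ-≤ (+ 2) (climb-≤ n (≤-by 2≤ (regroup (+ n) x y))) ⟩
        + 2 + (+ n + f y)  ≡⟨ ℤ.+-assoc (+ 2) (+ n) (f y) ⟨
        + 2 + + n + f y    ∎
        where
        open ℤ.≤-Reasoning
        regroup : ∀ n x y → + 2 + n + (x + y) - + 2 ≡ n + y - - x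
        regroup = solve-∀

  -- Mixing with the complement gives `q - f (q - p)`, the motion from the other end. Both points of
  -- the exchange are thus instances of one construction.
  complement : ∀ {f} → OddStaircase f → OddStaircase (λ t → t - f t)
  complement {f} F = record
    { odd   = λ t → trans (cong (λ z → - t - z) (odd t)) (neg-distrib t (f t))
    ; rise  = λ t → ≤-by (climb t) (eq₁ t (f t) (f (1ℤ + t)))
    ; climb = λ t → ≤-by (rise t) (eq₂ t (f t) (f (1ℤ + t)))
    }
    where
    open OddStaircase F
    neg-distrib : ∀ t s → - t - - s ≡ - (t - s)
    neg-distrib = solve-∀
    eq₁ : ∀ t s s′ → 1ℤ + s - s′ ≡ 1ℤ + t - s′ - (t - s)
    eq₁ = solve-∀
    eq₂ : ∀ t s s′ → s′ - s ≡ 1ℤ + (t - s) - (1ℤ + t - s′)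
    eq₂ = solve-∀

  -- The bounded staircases `ψ K`.

  ramp : ℕ → ℕ → ℕ
  ramp K n = 2 ℕ.⊓ (n ∸ K)

  ramp-rise : ∀ K n → ramp K n ℕ.≤ ramp K (suc n)
  ramp-rise K n = ℕ.⊓-monoʳ-≤ 2 (ℕ.∸-monoˡ-≤ K (ℕ.n≤1+n n))

  ramp-climb : ∀ K n → ramp K (suc n) ℕ.≤ suc (ramp K n)
  ramp-climb K n = ℕ.⊓-mono-≤ (ℕ.n≤1+n 2)
    (ℕ.m≤n+o⇒m∸n≤o (suc n) K (subst (suc n ℕ.≤_) (sym (ℕ.+-suc K (n ∸ K))) (ℕ.s≤s (ℕ.m≤n+m∸n n K))))

  ramp-0 : ∀ K → ramp K 0 ≡ 0
  ramp-0 K rewrite ℕ.0∸n≡0 K = refl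

  ramp-K : ∀ K i → ramp K (i ℕ.+ K) ≡ 2 ℕ.⊓ i
  ramp-K K i = cong (2 ℕ.⊓_) (ℕ.m+n∸n≡m i K)

  -- The steps of ψ K are at ±(K + 1) and ±(K + 2).
  ψ : ℕ → ℤ → ℤ
  ψ K (+ n)    = + ramp K n
  ψ K -[1+ n ] = - + ramp K (suc n)

  ψ-staircase : ∀ K → OddStaircase (ψ K)
  ψ-staircase K = record { odd = odd ; rise = rise ; climb = climb }
    where
    odd : ∀ t → ψ K (- t) ≡ - ψ K t
    odd (+ 0)     rewrite ramp-0 K = refl
    odd (+ suc n) = refl
    odd -[1+ n ]  = sym (ℤ.neg-involutive _)

    rise : ∀ t → ψ K t ≤ ψ K (1ℤ + t)
    rise (+ n)        = +≤+ (ramp-rise K n)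
    rise -[1+ zero ]  = ℤ.neg-≤-pos
    rise -[1+ suc n ] = ℤ.neg-mono-≤ (+≤+ (ramp-rise K (suc n)))

    swap : ∀ s t → 1ℤ + s - t ≡ 1ℤ + - t - - s
    swap = solve-∀

    climb : ∀ t → ψ K (1ℤ + t) ≤ 1ℤ + ψ K t
    climb (+ n)        = +≤+ (ramp-climb K n)
    climb -[1+ zero ]  = subst (_≤ 1ℤ + - + ramp K 1) -ramp-0 (≤-by (+≤+ (ramp-climb K 0)) (swap (+ ramp K 0) (+ ramp K 1)))
      where
      -ramp-0 : - + ramp K 0 ≡ + ramp K 0
      -ramp-0 rewrite ramp-0 K = refl
    climb -[1+ suc n ] = ≤-by (+≤+ (ramp-climb K (suc n))) (swap (+ ramp K (suc n)) (+ ramp K (suc (suc n))))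

  ∣ψ∣≤2 : ∀ K t → ∃[ n ] n ℕ.≤ 2 × (ψ K t ≡ + n ⊎ ψ K t ≡ - + n)
  ∣ψ∣≤2 K (+ n)    = _ , ℕ.m⊓n≤m 2 (n ∸ K) , inj₁ refl
  ∣ψ∣≤2 K -[1+ n ] = _ , ℕ.m⊓n≤m 2 (suc n ∸ K) , inj₂ refl

  -- The upper pair of steps starts at `K`, the lower pair at `-(K + 2)`. So `K` is `D` for
  -- nonnegative `D` and `- D - 2` for `D` at most -2. For `D = -1`, `K = 0` joins both pairs into
  -- one slope from -2 to 2.
  ψ-steps-at : ∀ D → ∃[ K ] 1ℤ + ψ K D ≤ ψ K (1ℤ + D) × + 2 + ψ K D ≤ ψ K (+ 2 + D)
  ψ-steps-at (+ n) = n , ψ1 , ψ2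
    where
    ψ1 : 1ℤ + + ramp n n ≤ + ramp n (suc n)
    ψ1 rewrite ramp-K n 0 | ramp-K n 1 = ℤ.≤-refl
    ψ2 : + 2 + + ramp n n ≤ + ramp n (suc (suc n))
    ψ2 rewrite ramp-K n 0 | ramp-K n 2 = ℤ.≤-refl
  ψ-steps-at -[1+ 0 ]           = 0 , ℤ.≤-refl , ℤ.≤-refl
  ψ-steps-at -[1+ 1 ]           = 0 , ℤ.≤-refl , ℤ.≤-refl
  ψ-steps-at -[1+ suc (suc n) ] = suc n , ψ1 , ψ2
    where
    ψ1 : 1ℤ + - + ramp (suc n) (3 ℕ.+ n) ≤ - + ramp (suc n) (2 ℕ.+ n)
    ψ1 rewrite ramp-K (suc n) 1 | ramp-K (suc n) 2 = ℤ.≤-refl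
    ψ2 : + 2 + - + ramp (suc n) (3 ℕ.+ n) ≤ - + ramp (suc n) (1 ℕ.+ n)
    ψ2 rewrite ramp-K (suc n) 0 | ramp-K (suc n) 2 = ℤ.≤-refl

  -- Mixing two integers by a staircase.

  mix : (ℤ → ℤ) → ℤ → ℤ → ℤ
  mix f p q = p + f (q - p)

  module _ {f : ℤ → ℤ} (F : OddStaircase f) where
    open OddStaircase F

    -- This is what oddness is for: inequalities on differences of coordinates reduce to
    -- inequalities on sums.
    mix-neg : ∀ p q → mix f (- p) (- q) ≡ - mix f p q
    mix-neg p q = begin
      - p + f (- q - - p)  ≡⟨ cong (λ z → - p + f z) (solve (p ∷ q ∷ [])) ⟩
      - p + f (- (q - p))  ≡⟨ cong (λ z → - p + z) (odd (q - p)) ⟩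
      - p + - f (q - p)    ≡⟨ ℤ.neg-distrib-+ p (f (q - p)) ⟨
      - mix f p q          ∎
      where open ≡-Reasoning

    mix-self : ∀ p → mix f p p ≡ p
    mix-self p = trans (cong (λ z → p + f z) (ℤ.+-inverseʳ p)) (trans (cong (λ z → p + z) zero-fixed) (ℤ.+-identityʳ p))

    -- The slack of the inequality at `p`, `p′` serves as `T` in `preserves-≥0`, the moves `q - p`
    -- and `q′ - p′` as `x` and `y`.
    mix-≥0 : ∀ c p q p′ q′ → 0ℤ ≤ c + (p + p′) → 0ℤ ≤ c + (q + q′) →
             0ℤ ≤ c + (mix f p q + mix f p′ q′)
    mix-≥0 c p q p′ q′ 0≤p 0≤q =
      ≤-by (preserves-≥0 (c + (p + p′)) {q - p} {q′ - p′} 0≤p (≤-by 0≤q (eq₁ c p p′ q q′)))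
           (eq₂ c p p′ (f (q - p)) (f (q′ - p′)))
      where
      eq₁ : ∀ c p p′ q q′ → c + (q + q′) - 0ℤ ≡ c + (p + p′) + (q - p + (q′ - p′)) - 0ℤ
      eq₁ = solve-∀
      eq₂ : ∀ c p p′ r r′ → c + (p + p′) + (r + r′) - 0ℤ ≡ c + (p + r + (p′ + r′)) - 0ℤ
      eq₂ = solve-∀

    mix-diff-≥0 : ∀ c p q p′ q′ → 0ℤ ≤ c + (p - p′) → 0ℤ ≤ c + (q - q′) →
                  0ℤ ≤ c + (mix f p q - mix f p′ q′)
    mix-diff-≥0 c p q p′ q′ 0≤p 0≤q =
      subst (λ z → 0ℤ ≤ c + (mix f p q + z)) (mix-neg p′ q′) (mix-≥0 c p q (- p′) (- q′) 0≤p 0≤q)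

    mix-mono : ∀ {p q p′ q′} → p ≤ p′ → q ≤ q′ → mix f p q ≤ mix f p′ q′
    mix-mono {p} {q} {p′} {q′} p≤ q≤ =
      ≤-by (mix-diff-≥0 0ℤ p′ q′ p q (≤-by p≤ (eq p p′)) (≤-by q≤ (eq q q′))) (sym (eq (mix f p q) (mix f p′ q′)))
      where
      eq : ∀ a b → b - a ≡ 0ℤ + (b - a) - 0ℤ
      eq = solve-∀

    -- Made for `e₀`: the old potential only satisfies a bound weaker by 2, yet the mixture has to
    -- satisfy the new one. The steps start at `p - q`, the negative of the first move, as
    -- `preserves-≥2` asks.
    mix-≥2 : ∀ c p q p′ q′ → 1ℤ + f (p - q) ≤ f (1ℤ + (p - q)) → + 2 + f (p - q) ≤ f (+ 2 + (p - q)) →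
             0ℤ ≤ + 2 + c + (p + p′) → 0ℤ ≤ c + (q + q′) →
             0ℤ ≤ c + (mix f p q + mix f p′ q′)
    mix-≥2 c p q p′ q′ step₁ step₂ 0≤p 0≤q =
      ≤-by (preserves-≥2 (+ 2 + c + (p + p′)) {q - p} {q′ - p′}
              (subst (λ z → 1ℤ + f z ≤ f (1ℤ + z)) flip step₁)
              (subst (λ z → + 2 + f z ≤ f (+ 2 + z)) flip step₂)
              0≤p (≤-by 0≤q (eq₁ c p p′ q q′)))
           (eq₂ c p p′ (f (q - p)) (f (q′ - p′)))
      where
      flip : p - q ≡ - (q - p)
      flip = solve (p ∷ q ∷ [])
      eq₁ : ∀ c p p′ q q′ → c + (q + q′) - 0ℤ ≡ + 2 + c + (p + p′) + (q - p + (q′ - p′)) - + 2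
      eq₁ = solve-∀
      eq₂ : ∀ c p p′ r r′ → + 2 + c + (p + p′) + (r + r′) - + 2 ≡ c + (p + r + (p′ + r′)) - 0ℤ
      eq₂ = solve-∀

  mix-complement : ∀ f p q → mix f p q + mix (λ t → t - f t) p q ≡ p + q
  mix-complement f p q = eq p q (f (q - p))
    where
    eq : ∀ p q r → p + r + (p + (q - p - r)) ≡ p + q
    eq = solve-∀

  weaken-sum : ∀ c {p p′ q q′} → 0ℤ ≤ c + (p + p′) → p ≤ q → p′ ≤ q′ → 0ℤ ≤ c + (q + q′)
  weaken-sum c 0≤ p≤q p′≤q′ = ℤ.≤-trans 0≤ (ℤ.+-monoʳ-≤ c (ℤ.+-mono-≤ p≤q p′≤q′))

  -- Points of the grid in integer coordinates.

  -- A grid point at distance r from the centre and height y is stored as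
  -- hi = y + r and lo = y − r: this turns the grid into the integer lattice.
  record Point (k : ℕ) : Set where
    constructor point
    field
      ray   : Fin k
      hi lo : ℤ
      lo≤hi : lo ≤ hi

  open Point

  -- y + ξ and y − ξ, where ξ is the signed distance from the centre in the
  -- direction of ray ℓ.
  up down : ∀ {k} → Fin k → Point k → ℤ
  up   ℓ w = if does (ray w Fin.≟ ℓ) then hi w else lo w
  down ℓ w = if does (ray w Fin.≟ ℓ) then lo w else hi w

  module _ {k : ℕ} where

    on-ray : ∀ {ℓ} (w : Point k) → ray w ≡ ℓ → up ℓ w ≡ hi w × down ℓ w ≡ lo w
    on-ray {ℓ} w eq with ray w Fin.≟ ℓ
    ... | yes _  = refl , refl
    ... | no neq = contradiction eq neq

    off-ray : ∀ {ℓ} (w : Point k) → ray w ≢ ℓ → up ℓ w ≡ lo w × down ℓ w ≡ hi w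
    off-ray {ℓ} w neq with ray w Fin.≟ ℓ
    ... | yes eq = contradiction eq neq
    ... | no _   = refl , refl

    lo≤up : ∀ ℓ (w : Point k) → lo w ≤ up ℓ w
    lo≤up ℓ w with ray w Fin.≟ ℓ
    ... | yes _ = lo≤hi w
    ... | no _  = ℤ.≤-refl

    lo≤down : ∀ ℓ (w : Point k) → lo w ≤ down ℓ w
    lo≤down ℓ w with ray w Fin.≟ ℓ
    ... | yes _ = ℤ.≤-refl
    ... | no _  = lo≤hi w

    up≤hi : ∀ ℓ (w : Point k) → up ℓ w ≤ hi w
    up≤hi ℓ w with ray w Fin.≟ ℓ
    ... | yes _ = ℤ.≤-refl
    ... | no _  = lo≤hi w

    up+down : ∀ ℓ (w : Point k) → up ℓ w + down ℓ w ≡ hi w + lo w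
    up+down ℓ w with ray w Fin.≟ ℓ
    ... | yes _ = refl
    ... | no _  = ℤ.+-comm (lo w) (hi w)

    -- dist − y − y′ ≤ c in the coordinates above.
    data Compat (c : ℤ) (w w′ : Point k) : Set where
      same : ray w ≡ ray w′ → 0ℤ ≤ c + (lo w + hi w′) → 0ℤ ≤ c + (hi w + lo w′) → Compat c w w′
      diff : ray w ≢ ray w′ → 0ℤ ≤ c + (lo w + lo w′) → Compat c w w′

    -- Signed distances towards two different rays add up to at most the distance, and signed
    -- distances towards one ray differ by at most the distance (`along`). Hence `Compat` gives
    -- linear inequalities for whichever rays the interpolated points lie on, even if `w` and `w′`
    -- lie elsewhere.
    apart : ∀ {c} {w w′ : Point k} → Compat c w w′ → ∀ {ℓ ℓ′} → ℓ ≢ ℓ′ → 0ℤ ≤ c + (down ℓ w + down ℓ′ w′)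
    apart {c} {w} {w′} (diff _ ll) {ℓ} {ℓ′} _ = weaken-sum c ll (lo≤down ℓ w) (lo≤down ℓ′ w′)
    apart {c} {w} {w′} (same eq lh hl) {ℓ} {ℓ′} ℓ≢ℓ′ with ray w Fin.≟ ℓ
    ... | yes w≡ℓ rewrite proj₂ (off-ray {ℓ′} w′ (λ w′≡ℓ′ → ℓ≢ℓ′ (trans (sym w≡ℓ) (trans eq w′≡ℓ′)))) = lh
    ... | no _    = weaken-sum c hl (ℤ.≤-refl {hi w}) (lo≤down ℓ′ w′)

    along : ∀ {c} {w w′ : Point k} → Compat c w w′ → ∀ ℓ →
            0ℤ ≤ c + (down ℓ w + up ℓ w′) × 0ℤ ≤ c + (up ℓ w + down ℓ w′)
    along {c} {w} {w′} (diff _ ll) ℓ =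
      weaken-sum c ll (lo≤down ℓ w) (lo≤up ℓ w′) , weaken-sum c ll (lo≤up ℓ w) (lo≤down ℓ w′)
    along {c} {w} {w′} (same eq lh hl) ℓ rewrite eq with ray w′ Fin.≟ ℓ
    ... | yes _ = lh , hl
    ... | no _  = hl , lh

    -- Interpolation along the line through two legs.

    -- Side u v p q: p and q are the values at u and v of one of the two
    -- coordinates of the line through their legs.
    data Side (u v : Point k) : ℤ → ℤ → Set where
      high : Side u v (hi u) (up (ray u) v)
      low  : Side u v (lo u) (down (ray u) v)

    low-≤ : ∀ {u v p q} → Side u v p q → lo u ≤ p
    low-≤ {u} high = lo≤hi u
    low-≤     low  = ℤ.≤-refl

    -- Seen from `ray v` instead of a different `ray u`, the line is reversed and its two
    -- coordinates change places.
    sides : ∀ u v {ℓ} → ℓ ≡ ray u ⊎ ℓ ≡ ray v →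
            (up ℓ u ≡ hi u × up ℓ v ≡ up (ray u) v × down ℓ u ≡ lo u × down ℓ v ≡ down (ray u) v)
          ⊎ (up ℓ u ≡ lo u × up ℓ v ≡ down (ray u) v × down ℓ u ≡ hi u × down ℓ v ≡ up (ray u) v)
    sides u v (inj₁ refl) = inj₁ (proj₁ (on-ray u refl) , refl , proj₂ (on-ray u refl) , refl)
    sides u v (inj₂ refl) with ray u Fin.≟ ray v
    ... | yes eq = inj₁ (refl , cong (λ ℓ → up ℓ v) (sym eq) , refl , cong (λ ℓ → down ℓ v) (sym eq))
    ... | no neq = inj₂ ( refl , trans (proj₁ (on-ray v refl)) (sym (proj₂ (off-ray v (≢-sym neq))))
                        , refl , trans (proj₂ (on-ray v refl)) (sym (proj₁ (off-ray v (≢-sym neq)))))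

    up-side : ∀ u v {ℓ} → ℓ ≡ ray u ⊎ ℓ ≡ ray v → Side u v (up ℓ u) (up ℓ v)
    up-side u v on with sides u v on
    ... | inj₁ (a , b , _) rewrite a | b = high
    ... | inj₂ (a , b , _) rewrite a | b = low

    down-side : ∀ u v {ℓ} → ℓ ≡ ray u ⊎ ℓ ≡ ray v → Side u v (down ℓ u) (down ℓ v)
    down-side u v on with sides u v on
    ... | inj₁ (_ , _ , a , b) rewrite a | b = low
    ... | inj₂ (_ , _ , a , b) rewrite a | b = high

    -- Coordinates are taken relative to the ray of `w` itself, since the mixture may fall on either
    -- side of the centre.
    record Interpolant (f : ℤ → ℤ) (u v w : Point k) : Set where
      field
        on-line : ray w ≡ ray u ⊎ ray w ≡ ray v
        hi-mix  : hi w ≡ mix f (up (ray w) u) (up (ray w) v)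
        lo-mix  : lo w ≡ mix f (down (ray w) u) (down (ray w) v)

      -- Reversing the line does not affect the sum of the two coordinates, so it can be computed
      -- from `ray u` wherever `w` lies. As twice the height, it is what enters the objective.
      hi+lo : hi w + lo w ≡ mix f (hi u) (up (ray u) v) + mix f (lo u) (down (ray u) v)
      hi+lo with sides u v on-line
      ... | inj₁ (a , b , c , d) rewrite hi-mix | lo-mix | a | b | c | d = refl
      ... | inj₂ (a , b , c , d) rewrite hi-mix | lo-mix | a | b | c | d =
        ℤ.+-comm (mix f (lo u) (down (ray u) v)) _

  open Interpolant

  module _ {k : ℕ} where

    -- On a common ray, monotonicity of `mix` keeps `lo` below `hi`. On different rays the line
    -- passes through the centre, and the order of the two mixed coordinates decides which ray
    -- carries the result.
    interpolate : ∀ {f} → OddStaircase f → ∀ (u v : Point k) → ∃[ w ] Interpolant f u v w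
    interpolate {f} F u v with ray u Fin.≟ ray v
    ... | yes eq = point (ray u) (mix f (hi u) (hi v)) (mix f (lo u) (lo v)) (mix-mono F (lo≤hi u) (lo≤hi v))
                 , record { on-line = inj₁ refl
                          ; hi-mix = sym (cong₂ (mix f) (proj₁ (on-ray u refl)) (proj₁ (on-ray v (sym eq))))
                          ; lo-mix = sym (cong₂ (mix f) (proj₂ (on-ray u refl)) (proj₂ (on-ray v (sym eq)))) }
    ... | no neq with mix f (lo u) (hi v) ℤ.≤? mix f (hi u) (lo v)
    ...   | yes le = point (ray u) (mix f (hi u) (lo v)) (mix f (lo u) (hi v)) le
                 , record { on-line = inj₁ refl
                          ; hi-mix = sym (cong₂ (mix f) (proj₁ (on-ray u refl)) (proj₁ (off-ray v (≢-sym neq))))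
                          ; lo-mix = sym (cong₂ (mix f) (proj₂ (on-ray u refl)) (proj₂ (off-ray v (≢-sym neq)))) }
    ...   | no nle = point (ray v) (mix f (lo u) (hi v)) (mix f (hi u) (lo v)) (ℤ.<⇒≤ (ℤ.≰⇒> nle))
                 , record { on-line = inj₂ refl
                          ; hi-mix = sym (cong₂ (mix f) (proj₁ (off-ray u neq)) (proj₁ (on-ray v refl)))
                          ; lo-mix = sym (cong₂ (mix f) (proj₂ (off-ray u neq)) (proj₂ (on-ray v refl))) }

    -- By `apart` and `along`, each inequality wanted for `w` and `w′` holds in the same two
    -- coordinates at both ends, and `step` carries it over. It is a parameter because `e₀` needs
    -- another argument than the remaining edges.
    compat-mix : ∀ {f c₁ c₂ c₃} {u v w u′ v′ w′ : Point k} →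
      (∀ {p q p′ q′} → Side u v p q → Side u′ v′ p′ q′ →
         0ℤ ≤ c₁ + (p + p′) → 0ℤ ≤ c₂ + (q + q′) → 0ℤ ≤ c₃ + (mix f p q + mix f p′ q′)) →
      Compat c₁ u u′ → Compat c₂ v v′ → Interpolant f u v w → Interpolant f u′ v′ w′ → Compat c₃ w w′
    compat-mix {f} {c₁} {c₂} {c₃} {u = u} {v} {w} {u′} {v′} {w′} step uu′ vv′ I I′ with ray w Fin.≟ ray w′
    ... | no neq = diff neq
      (subst (λ z → 0ℤ ≤ c₃ + z) (sym (cong₂ _+_ (lo-mix I) (lo-mix I′)))
        (step (down-side u v (on-line I)) (down-side u′ v′ (on-line I′)) (apart uu′ neq) (apart vv′ neq)))
    ... | yes eq = same eq
      (subst (λ z → 0ℤ ≤ c₃ + z) (sym (cong₂ _+_ (lo-mix I) (hi-mix I′)))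
        (step (down-side u v (on-line I)) (up-side u′ v′ (on-line I′))
          (subst (λ ℓ → 0ℤ ≤ c₁ + (down (ray w) u + up ℓ u′)) eq (proj₁ (along uu′ (ray w))))
          (subst (λ ℓ → 0ℤ ≤ c₂ + (down (ray w) v + up ℓ v′)) eq (proj₁ (along vv′ (ray w))))))
      (subst (λ z → 0ℤ ≤ c₃ + z) (sym (cong₂ _+_ (hi-mix I) (lo-mix I′)))
        (step (up-side u v (on-line I)) (down-side u′ v′ (on-line I′))
          (subst (λ ℓ → 0ℤ ≤ c₁ + (up (ray w) u + down ℓ u′)) eq (proj₂ (along uu′ (ray w))))
          (subst (λ ℓ → 0ℤ ≤ c₂ + (up (ray w) v + down ℓ v′)) eq (proj₂ (along vv′ (ray w))))))

    -- Two sums with complementary sides add up to at least 2c, so they are not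
    -- both below c + 2; hence a single coordinate of one endpoint carries all
    -- the nearly tight inequalities, and the steps of ψ are placed there.
    steps-for-tight : ∀ c → 0ℤ ≤ c → (u v u′ v′ : Point k) → 0ℤ ≤ hi u + lo u → 0ℤ ≤ hi u′ + lo u′ →
      ∃[ K ] (∀ {p q p′ q′} → Side u v p q → Side u′ v′ p′ q′ →
        0ℤ ≤ + 2 + c + (p + p′) → 0ℤ ≤ c + (q + q′) → 0ℤ ≤ c + (mix (ψ K) p q + mix (ψ K) p′ q′))
    steps-for-tight c 0≤c u v u′ v′ 0≤u 0≤u′ with 0ℤ ℤ.≤? c + (lo u + hi u′)
    ... | yes slack = K , claim
      where
      steps = ψ-steps-at (lo u′ - down (ray u′) v′)
      K = proj₁ steps
      swap : ∀ c p p′ → c + (p + p′) ≡ c + (p′ + p)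
      swap = solve-∀
      claim : ∀ {p q p′ q′} → Side u v p q → Side u′ v′ p′ q′ →
        0ℤ ≤ + 2 + c + (p + p′) → 0ℤ ≤ c + (q + q′) → 0ℤ ≤ c + (mix (ψ K) p q + mix (ψ K) p′ q′)
      claim {p} {q} {p′} {q′} s low 0≤p 0≤q =
        subst (0ℤ ≤_) (swap c (mix (ψ K) p′ q′) (mix (ψ K) p q))
          (mix-≥2 (ψ-staircase K) c p′ q′ p q (proj₁ (proj₂ steps)) (proj₂ (proj₂ steps))
            (subst (0ℤ ≤_) (swap (+ 2 + c) p p′) 0≤p) (subst (0ℤ ≤_) (swap c q q′) 0≤q))
      -- As `lo u` is at most `p`, `slack` gives the stricter bound at `u` as well, and every
      -- staircase keeps it.
      claim {p} {q} {p′} {q′} s high _ 0≤q =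
        mix-≥0 (ψ-staircase K) c p q p′ q′ (weaken-sum c slack (low-≤ s) (ℤ.≤-refl {p′})) 0≤q
    ... | no tight = K , claim
      where
      steps = ψ-steps-at (lo u - down (ray u) v)
      K = proj₁ steps
      regroup : ∀ c a b a′ b′ → c + c + ((a + b) + (a′ + b′)) - (c + (b + a′)) ≡ c + (a + b′) - 0ℤ
      regroup = solve-∀
      slack : 0ℤ ≤ c + (hi u + lo u′)
      slack = ≤-by (ℤ.≤-trans (ℤ.<⇒≤ (ℤ.≰⇒> tight)) (ℤ.+-mono-≤ (ℤ.+-mono-≤ 0≤c 0≤c) (ℤ.+-mono-≤ 0≤u 0≤u′)))
                   (regroup c (hi u) (lo u) (hi u′) (lo u′))
      claim : ∀ {p q p′ q′} → Side u v p q → Side u′ v′ p′ q′ →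
        0ℤ ≤ + 2 + c + (p + p′) → 0ℤ ≤ c + (q + q′) → 0ℤ ≤ c + (mix (ψ K) p q + mix (ψ K) p′ q′)
      claim {p} {q} {p′} {q′} low s′ 0≤p 0≤q =
        mix-≥2 (ψ-staircase K) c p q p′ q′ (proj₁ (proj₂ steps)) (proj₂ (proj₂ steps)) 0≤p 0≤q
      claim {p} {q} {p′} {q′} high s′ _ 0≤q =
        mix-≥0 (ψ-staircase K) c p q p′ q′ (weaken-sum c slack (ℤ.≤-refl {p}) (low-≤ s′)) 0≤q

  -- Half-integers as rationals, and parity.

  fromℤ-+ : ∀ a b → fromℤ (a + b) ≡ fromℤ a ℚ.+ fromℤ b
  fromℤ-+ a b = ℚ.toℚᵘ-injective (ℚᵘ.≃-trans (ℚᵘ.*≡* eq) (ℚᵘ.≃-sym (ℚ.toℚᵘ-homo-+ (fromℤ a) (fromℤ b))))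
    where
    eq : (a + b) ℤ.* + 1 ≡ (a ℤ.* + 1 + b ℤ.* + 1) ℤ.* + 1
    eq = solve (a ∷ b ∷ [])

  fromℤ-neg : ∀ a → fromℤ (- a) ≡ ℚ.- fromℤ a
  fromℤ-neg (+ 0)     = refl
  fromℤ-neg (+ suc n) = refl
  fromℤ-neg -[1+ n ]  = refl

  fromℤ-mono : ∀ {a b} → a ≤ b → fromℤ a ℚ.≤ fromℤ b
  fromℤ-mono {a} {b} a≤b = *≤* (subst₂ _≤_ (sym (ℤ.*-identityʳ a)) (sym (ℤ.*-identityʳ b)) a≤b)

  fromℤ-cancel : ∀ {a b} → fromℤ a ℚ.≤ fromℤ b → a ≤ b
  fromℤ-cancel {a} {b} (*≤* a≤b) = subst₂ _≤_ (ℤ.*-identityʳ a) (ℤ.*-identityʳ b) a≤b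

  double : ∀ r → fromℕ 2 ℚ.* r ≡ r ℚ.+ r
  double r = trans (ℚ.*-distribʳ-+ r 1ℚ 1ℚ) (cong₂ ℚ._+_ (ℚ.*-identityˡ r) (ℚ.*-identityˡ r))

  opaque
    -- Opaque, so that half-integers are handled by additivity, order and doubling and never as
    -- normalised fractions.
    half : ℤ → ℚ
    half z = ½ ℚ.* fromℤ z

    half-+ : ∀ a b → half (a + b) ≡ half a ℚ.+ half b
    half-+ a b = trans (cong (½ ℚ.*_) (fromℤ-+ a b)) (ℚ.*-distribˡ-+ ½ (fromℤ a) (fromℤ b))

    half-neg : ∀ a → half (- a) ≡ ℚ.- half a
    half-neg a = trans (cong (½ ℚ.*_) (fromℤ-neg a)) (sym (ℚ.neg-distribʳ-* ½ (fromℤ a)))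

    half-mono : ∀ {a b} → a ≤ b → half a ℚ.≤ half b
    half-mono a≤b = ℚ.*-monoˡ-≤-nonNeg ½ (fromℤ-mono a≤b)

    half-cancel : ∀ {a b} → half a ℚ.≤ half b → a ≤ b
    half-cancel le = fromℤ-cancel (ℚ.*-cancelˡ-≤-pos ½ le)

    half-∣∣ : ∀ a → half (+ ℤ.∣ a ∣) ≡ ℚ.∣ half a ∣
    half-∣∣ a = sym (ℚ.∣p*q∣≡∣p∣*∣q∣ ½ (fromℤ a))

    half-double : ∀ a → half (a + a) ≡ fromℤ a
    half-double a = begin
      ½ ℚ.* fromℤ (a + a)                 ≡⟨ cong (½ ℚ.*_) (fromℤ-+ a a) ⟩
      ½ ℚ.* (fromℤ a ℚ.+ fromℤ a)         ≡⟨ cong (½ ℚ.*_) (double (fromℤ a)) ⟨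
      ½ ℚ.* (fromℕ 2 ℚ.* fromℤ a)         ≡⟨ ℚ.*-assoc ½ (fromℕ 2) (fromℤ a) ⟨
      1ℚ ℚ.* fromℤ a                      ≡⟨ ℚ.*-identityˡ (fromℤ a) ⟩
      fromℤ a                             ∎
      where open ≡-Reasoning

  half-- : ∀ a b → half (a - b) ≡ half a ℚ.- half b
  half-- a b = trans (half-+ a (- b)) (cong (half a ℚ.+_) (half-neg b))

  half-injective : ∀ {a b} → half a ≡ half b → a ≡ b
  half-injective eq = ℤ.≤-antisym (half-cancel (ℚ.≤-reflexive eq)) (half-cancel (ℚ.≤-reflexive (sym eq)))

  2*half : ∀ a → fromℕ 2 ℚ.* half a ≡ fromℤ a
  2*half a = trans (double (half a)) (trans (sym (half-+ a a)) (half-double a))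

  half-of-double : ∀ {r a} → fromℕ 2 ℚ.* r ≡ fromℤ a → r ≡ half a
  half-of-double {r} {a} eq = ℚ.≤-antisym (ℚ.*-cancelˡ-≤-pos (fromℕ 2) (ℚ.≤-reflexive eq′))
                                          (ℚ.*-cancelˡ-≤-pos (fromℕ 2) (ℚ.≤-reflexive (sym eq′)))
    where
    eq′ : fromℕ 2 ℚ.* r ≡ fromℕ 2 ℚ.* half a
    eq′ = trans eq (sym (2*half a))

  even-or-odd : ∀ a → ∃[ b ] (a ≡ b + b ⊎ a ≡ 1ℤ + (b + b))
  even-or-odd (+ zero)  = 0ℤ , inj₁ refl
  even-or-odd (+ suc n) with even-or-odd (+ n)
  ... | b , inj₁ eq = b , inj₂ (cong (λ z → 1ℤ + z) eq)
  ... | b , inj₂ eq = 1ℤ + b , inj₁ (trans (cong (λ z → 1ℤ + z) eq) (solve (b ∷ [])))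
  even-or-odd -[1+ zero ] = -[1+ 0 ] , inj₂ refl
  even-or-odd -[1+ suc n ] with even-or-odd -[1+ n ]
  ... | b , inj₁ eq = -[1+ 0 ] + b , inj₂ (trans (cong (λ z → -[1+ 0 ] + z) eq) (solve (b ∷ [])))
  ... | b , inj₂ eq = b , inj₁ (trans (cong (λ z → -[1+ 0 ] + z) eq) (solve (b ∷ [])))

  0≤t+t⇒0≤t : ∀ t → 0ℤ ≤ t + t → 0ℤ ≤ t
  0≤t+t⇒0≤t (+ n) _ = +≤+ ℕ.z≤n

  double-injective : ∀ {a b} → a + a ≡ b + b → a ≡ b
  double-injective {a} {b} eq = ℤ.≤-antisym (le b a (sym eq)) (le a b eq)
    where
    regroup : ∀ a b → b + b - (a + a) ≡ (b - a) + (b - a)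
    regroup = solve-∀
    le : ∀ a b → a + a ≡ b + b → b ≤ a
    le a b eq = ℤ.0≤i-j⇒j≤i (0≤t+t⇒0≤t (a - b)
      (subst (0ℤ ≤_) (regroup b a) (ℤ.i≤j⇒0≤j-i (ℤ.≤-reflexive (sym eq)))))

  double≢1 : ∀ a → a + a ≢ 1ℤ
  double≢1 (+ suc n) eq with trans (sym (ℕ.+-suc n n)) (ℕ.suc-injective (ℤ.+-injective eq))
  ... | ()

  double≢1+double : ∀ a b → a + a ≢ 1ℤ + (b + b)
  double≢1+double a b eq = double≢1 (a - b) (trans (sym (regroup a b)) (trans (cong (_- (b + b)) eq) (regroup′ b)))
    where
    regroup : ∀ a b → a + a - (b + b) ≡ (a - b) + (a - b)
    regroup = solve-∀
    regroup′ : ∀ b → 1ℤ + (b + b) - (b + b) ≡ 1ℤ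
    regroup′ = solve-∀

  integral-half : ∀ a → Integral (half (a + a))
  integral-half a = a , half-double a

  properHalfIntegral-half : ∀ {z} b → z ≡ 1ℤ + (b + b) → ProperHalfIntegral (half z)
  properHalfIntegral-half {z} b refl = (z , 2*half z) , λ (a , eq) →
    double≢1+double a b (sym (half-injective (trans eq (sym (half-double a)))))

  odd-double : ∀ {r} → ProperHalfIntegral r → ∃[ b ] r ≡ half (1ℤ + (b + b))
  odd-double ((a , 2r≡a) , ¬int) with even-or-odd a
  ... | b , inj₁ refl = contradiction (b , trans (half-of-double 2r≡a) (half-double b)) ¬int
  ... | b , inj₂ refl = b , half-of-double 2r≡a

  -- Translation between grid points and integer coordinates.

  record Represents {k} (w : Point k) (g : Grid k) : Set where
    field
      ray≡    : ray w ≡ leg (x g)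
      radius≡ : radius (x g) ≡ half (hi w - lo w)
      y≡      : y g ≡ half (hi w + lo w)

  open Represents

  coordinates : ∀ {k} (g : Grid k) → ∃[ w ] Represents w g
  coordinates {k} g = build (parity g)
    where
    build-from : ∀ hi lo → radius (x g) ≡ half (hi - lo) → y g ≡ half (hi + lo) → ∃[ w ] Represents w g
    build-from h l r≡ y≡ = point (leg (x g)) h l
        (ℤ.0≤i-j⇒j≤i (half-cancel {0ℤ} {h - l} (subst₂ ℚ._≤_ (sym (half-double 0ℤ)) r≡ (nonneg (x g)))))
      , record { ray≡ = refl ; radius≡ = r≡ ; y≡ = y≡ }
    build : _ → ∃[ w ] Represents w g
    build (inj₁ ((r , r≡) , (t , t≡))) = build-from (t + r) (t - r)
      (trans r≡ (trans (sym (half-double r)) (cong half (solve (t ∷ r ∷ [])))))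
      (trans t≡ (trans (sym (half-double t)) (cong half (solve (t ∷ r ∷ [])))))
    build (inj₂ (r-half , t-half)) with odd-double r-half | odd-double t-half
    -- The radius is `r` plus one half and the height `t` plus one half: the halves add up to 1 in
    -- `hi` and cancel in `lo`.
    ... | r , r≡ | t , t≡ = build-from (1ℤ + (t + r)) (t - r)
      (trans r≡ (cong half (solve (t ∷ r ∷ []))))
      (trans t≡ (cong half (solve (t ∷ r ∷ []))))

  -- The parity condition holds because `hi - lo` and `hi + lo` differ by the even number `lo + lo`.
  toGrid : ∀ {k} → Point k → Grid k
  toGrid w = grid (star (half (hi w - lo w)) 0≤r (ray w)) (half (hi w + lo w)) parity-of
    where
    0≤r : 0ℚ ℚ.≤ half (hi w - lo w)
    0≤r = subst (ℚ._≤ half (hi w - lo w)) (half-double 0ℤ) (half-mono (ℤ.i≤j⇒0≤j-i (lo≤hi w)))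
    sum-via-difference : ∀ h l → h + l ≡ h - l + (l + l)
    sum-via-difference = solve-∀
    even-case : ∀ b l → b + b + (l + l) ≡ (b + l) + (b + l)
    even-case = solve-∀
    odd-case : ∀ b l → 1ℤ + (b + b) + (l + l) ≡ 1ℤ + ((b + l) + (b + l))
    odd-case = solve-∀
    parity-of : (Integral (half (hi w - lo w)) × Integral (half (hi w + lo w)))
              ⊎ (ProperHalfIntegral (half (hi w - lo w)) × ProperHalfIntegral (half (hi w + lo w)))
    parity-of with even-or-odd (hi w - lo w)
    ... | b , inj₁ eq = inj₁
      ( subst (λ z → Integral (half z)) (sym eq) (integral-half b)
      , subst (λ z → Integral (half z))
          (sym (trans (sum-via-difference (hi w) (lo w)) (trans (cong (_+ (lo w + lo w)) eq) (even-case b (lo w)))))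
          (integral-half (b + lo w)))
    ... | b , inj₂ eq = inj₂
      ( properHalfIntegral-half b eq
      , properHalfIntegral-half (b + lo w)
          (trans (sum-via-difference (hi w) (lo w)) (trans (cong (_+ (lo w + lo w)) eq) (odd-case b (lo w)))))

  toGrid-represents : ∀ {k} (w : Point k) → Represents w (toGrid w)
  toGrid-represents w = record { ray≡ = refl ; radius≡ = refl ; y≡ = refl }

  dist₂ : ∀ {k} → Point k → Point k → ℤ
  dist₂ w w′ = if does (ray w Fin.≟ ray w′)
               then + ℤ.∣ (hi w - lo w) - (hi w′ - lo w′) ∣
               else (hi w - lo w) + (hi w′ - lo w′)

  dist-half : ∀ {k} {w w′ : Point k} {g g′} → Represents w g → Represents w′ g′ →
              dist (x g) (x g′) ≡ half (dist₂ w w′)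
  dist-half {w = w} {w′} R R′ rewrite sym (ray≡ R) | sym (ray≡ R′) | radius≡ R | radius≡ R′ with does (ray w Fin.≟ ray w′)
  ... | true  = trans (cong ℚ.∣_∣ (sym (half-- (hi w - lo w) (hi w′ - lo w′)))) (sym (half-∣∣ _))
  ... | false = sym (half-+ (hi w - lo w) (hi w′ - lo w′))

  i≤∣i∣ : ∀ i → i ≤ + ℤ.∣ i ∣
  i≤∣i∣ (+ n)    = ℤ.≤-refl
  i≤∣i∣ -[1+ n ] = -≤+

  -- On a common ray the absolute value bounds both `δ` and `- δ`. Every resulting inequality is
  -- twice one of `Compat`, and the factor 2 cancels.
  dist₂⇒compat : ∀ {k} {w w′ : Point k} c → dist₂ w w′ - (hi w + lo w) - (hi w′ + lo w′) ≤ c + c → Compat c w w′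
  dist₂⇒compat {w = w} {w′} c le with ray w Fin.≟ ray w′
  ... | no neq = diff neq (0≤t+t⇒0≤t _ (≤-by le (eq c (hi w) (lo w) (hi w′) (lo w′))))
    where
    eq : ∀ c h l h′ l′ → c + c - ((h - l) + (h′ - l′) - (h + l) - (h′ + l′)) ≡ (c + (l + l′)) + (c + (l + l′)) - 0ℤ
    eq = solve-∀
  ... | yes eq = same eq
      (0≤t+t⇒0≤t _ (≤-by (ℤ.≤-trans (drop (i≤∣i∣ δ)) le) (eq₁ c (hi w) (lo w) (hi w′) (lo w′))))
      (0≤t+t⇒0≤t _ (≤-by (ℤ.≤-trans (drop (subst (- δ ≤_) (cong +_ (ℤ.∣-i∣≡∣i∣ δ)) (i≤∣i∣ (- δ)))) le) (eq₂ c (hi w) (lo w) (hi w′) (lo w′))))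
    where
    δ = (hi w - lo w) - (hi w′ - lo w′)
    drop : ∀ {a b} → a ≤ b → a - (hi w + lo w) - (hi w′ + lo w′) ≤ b - (hi w + lo w) - (hi w′ + lo w′)
    drop a≤b = ℤ.+-monoˡ-≤ (- (hi w′ + lo w′)) (ℤ.+-monoˡ-≤ (- (hi w + lo w)) a≤b)
    eq₁ : ∀ c h l h′ l′ → c + c - ((h - l) - (h′ - l′) - (h + l) - (h′ + l′)) ≡ (c + (l + h′)) + (c + (l + h′)) - 0ℤ
    eq₁ = solve-∀
    eq₂ : ∀ c h l h′ l′ → c + c - (- ((h - l) - (h′ - l′)) - (h + l) - (h′ + l′)) ≡ (c + (h + l′)) + (c + (h + l′)) - 0ℤ
    eq₂ = solve-∀

  compat⇒dist₂ : ∀ {k} {w w′ : Point k} c → Compat c w w′ → dist₂ w w′ - (hi w + lo w) - (hi w′ + lo w′) ≤ c + c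
  compat⇒dist₂ {w = w} {w′} c (diff neq ll) with ray w Fin.≟ ray w′
  ... | yes eq = contradiction eq neq
  ... | no _   = ≤-by (ℤ.+-mono-≤ ll ll) (eq c (hi w) (lo w) (hi w′) (lo w′))
    where
    eq : ∀ c h l h′ l′ → (c + (l + l′)) + (c + (l + l′)) - (0ℤ + 0ℤ) ≡ c + c - ((h - l) + (h′ - l′) - (h + l) - (h′ + l′))
    eq = solve-∀
  compat⇒dist₂ {w = w} {w′} c (same eq lh hl) with ray w Fin.≟ ray w′
  ... | no neq = contradiction eq neq
  ... | yes _ with ℤ.+∣i∣≡i⊎+∣i∣≡-i ((hi w - lo w) - (hi w′ - lo w′))
  ...   | inj₁ abs≡ rewrite abs≡ = ≤-by (ℤ.+-mono-≤ lh lh) (eq₁ c (hi w) (lo w) (hi w′) (lo w′))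
    where
    eq₁ : ∀ c h l h′ l′ → (c + (l + h′)) + (c + (l + h′)) - (0ℤ + 0ℤ) ≡ c + c - ((h - l) - (h′ - l′) - (h + l) - (h′ + l′))
    eq₁ = solve-∀
  ...   | inj₂ abs≡ rewrite abs≡ = ≤-by (ℤ.+-mono-≤ hl hl) (eq₂ c (hi w) (lo w) (hi w′) (lo w′))
    where
    eq₂ : ∀ c h l h′ l′ → (c + (h + l′)) + (c + (h + l′)) - (0ℤ + 0ℤ) ≡ c + c - (- ((h - l) - (h′ - l′)) - (h + l) - (h′ + l′))
    eq₂ = solve-∀

  2·_ : ℕ → ℤ
  2· d = + d + + d

  2·-half : ∀ d → fromℕ 2 ℚ.* fromℕ d ≡ half (2· d + 2· d)
  2·-half d = trans (double (fromℕ d)) (trans (sym (fromℤ-+ (+ d) (+ d))) (sym (half-double (2· d))))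

  module _ {k : ℕ} {w w′ : Point k} {g g′ : Grid k} (R : Represents w g) (R′ : Represents w′ g′) where

    dist-y-y : dist (x g) (x g′) ℚ.- y g ℚ.- y g′ ≡ half (dist₂ w w′ - (hi w + lo w) - (hi w′ + lo w′))
    dist-y-y rewrite dist-half R R′ | y≡ R | y≡ R′ = sym
      (trans (half-- (dist₂ w w′ - (hi w + lo w)) _) (cong (ℚ._- half (hi w′ + lo w′)) (half-- (dist₂ w w′) _)))

    edgeBound⇒compat : ∀ d → dist (x g) (x g′) ℚ.- y g ℚ.- y g′ ℚ.≤ fromℕ 2 ℚ.* fromℕ d → Compat (2· d) w w′
    edgeBound⇒compat d le = dist₂⇒compat (2· d) (half-cancel (subst₂ ℚ._≤_ dist-y-y (2·-half d) le))

    compat⇒edgeBound : ∀ d → Compat (2· d) w w′ → dist (x g) (x g′) ℚ.- y g ℚ.- y g′ ℚ.≤ fromℕ 2 ℚ.* fromℕ d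
    compat⇒edgeBound d C = subst₂ ℚ._≤_ (sym dist-y-y) (sym (2·-half d)) (half-mono (compat⇒dist₂ (2· d) C))

  -- Potentials in integer coordinates.

  module _ {k m : ℕ} (N : Network k m) (M : ℕ) where

    -- The counterpart of `IsPotential`. Apart from the fixed terminals, every condition bounds a
    -- sum or difference of two coordinates, the form that mixing preserves.
    record Feasible (c : Edge N → ℤ) (w : Vector (Point k) (k ℕ.+ m)) : Set where
      field
        compat   : ∀ e → Compat (c e) (w (source e)) (w (target e))
        terminal : ∀ s → ray (w (s ↑ˡ m)) ≡ s × hi (w (s ↑ˡ m)) ≡ + M × lo (w (s ↑ˡ m)) ≡ - + M
        nonneg   : ∀ i → 0ℤ ≤ hi (w i) + lo (w i)
        within   : ∀ i → 0ℤ ≤ 2· M + (lo (w i) - hi (w i))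

    open Feasible

    module _ {d : Cost N} {w : Vector (Point k) (k ℕ.+ m)} {p : Vector (Grid k) (k ℕ.+ m)}
             (R : ∀ i → Represents (w i) (p i)) where

      feasible : 0 ℕ.< M → IsPotential N d M p → Feasible (λ e → 2· d e) w
      feasible 0<M P = record
        { compat   = λ e → edgeBound⇒compat (R (source e)) (R (target e)) (d e) (P.edge-bound e)
        ; terminal = at-terminal
        ; nonneg   = λ i → half-cancel (subst₂ ℚ._≤_ (sym (half-double 0ℤ)) (y≡ (R i)) (P.y-nonneg i))
        ; within   = λ i → ≤-by (half-cancel (subst₂ ℚ._≤_ (radius≡ (R i)) (sym (half-double (+ M))) (P.within i)))
                                (regroup (2· M) (hi (w i)) (lo (w i)))
        }
        where
        module P = IsPotential P
        regroup : ∀ b h l → b - (h - l) ≡ b + (l - h) - 0ℤ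
        regroup = solve-∀
        at-terminal : ∀ s → ray (w (s ↑ˡ m)) ≡ s × hi (w (s ↑ˡ m)) ≡ + M × lo (w (s ↑ˡ m)) ≡ - + M
        at-terminal s with P.terminal s
        ... | (r≡M , r≡0⊎ray≡) , y≡0 = ray-eq r≡0⊎ray≡ , hi≡ , lo≡
          where
          i = s ↑ˡ m
          difference : hi (w i) - lo (w i) ≡ 2· M
          difference = half-injective (trans (sym (radius≡ (R i))) (trans r≡M (sym (half-double (+ M)))))
          total : hi (w i) + lo (w i) ≡ 0ℤ
          total = half-injective (trans (sym (y≡ (R i))) (trans y≡0 (sym (half-double 0ℤ))))
          split : ∀ h l → h + h ≡ (h - l) + (h + l)
          split = solve-∀
          hi≡ : hi (w i) ≡ + M
          hi≡ = double-injective (trans (split (hi (w i)) (lo (w i))) (trans (cong₂ _+_ difference total) (ℤ.+-identityʳ (2· M))))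
          isolate : ∀ h l → l ≡ (h + l) - h
          isolate = solve-∀
          lo≡ : lo (w i) ≡ - + M
          lo≡ = trans (isolate (hi (w i)) (lo (w i))) (trans (cong₂ _-_ total hi≡) (ℤ.+-identityˡ (- + M)))
          ray-eq : radius (x (p i)) ≡ 0ℚ ⊎ leg (x (p i)) ≡ s → ray (w i) ≡ s
          -- A terminal at the centre would have no definite leg; positivity of `M` excludes this.
          ray-eq (inj₁ r≡0)  = contradiction (sym (ℤ.+-injective (cong ℚ.numerator (trans (sym r≡M) r≡0)))) (ℕ.<⇒≢ 0<M)
          ray-eq (inj₂ ray≡s) = trans (ray≡ (R i)) ray≡s

      potential : Feasible (λ e → 2· d e) w → IsPotential N d M p
      potential F = record
        { edge-bound = λ e → compat⇒edgeBound (R (source e)) (R (target e)) (d e) (compat F e)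
        ; terminal   = at-terminal
        ; y-nonneg   = λ i → subst₂ ℚ._≤_ (half-double 0ℤ) (sym (y≡ (R i))) (half-mono (nonneg F i))
        ; within     = λ i → subst₂ ℚ._≤_ (sym (radius≡ (R i))) (half-double (+ M))
                               (half-mono (≤-by (within F i) (regroup (2· M) (hi (w i)) (lo (w i)))))
        }
        where
        regroup : ∀ b h l → b + (l - h) - 0ℤ ≡ b - (h - l)
        regroup = solve-∀
        at-terminal : ∀ s → (x (p (s ↑ˡ m)) ≈ onLeg M s) × y (p (s ↑ˡ m)) ≡ 0ℚ
        at-terminal s with terminal F s
        ... | ray≡s , hi≡ , lo≡ =
          ( trans (radius≡ (R i)) (trans (cong half (trans (cong₂ _-_ hi≡ lo≡) (cong (λ z → + M + z) (ℤ.neg-involutive (+ M))))) (half-double (+ M)))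
          , inj₂ (trans (sym (ray≡ (R i))) ray≡s)) ,
          trans (y≡ (R i)) (trans (cong half (trans (cong₂ _+_ hi≡ lo≡) (ℤ.+-inverseʳ (+ M)))) (half-double 0ℤ))
          where i = s ↑ˡ m

    -- At the terminals `u` and `v` agree, and mixing equal values changes nothing. Edge bounds are
    -- left to the caller, since that of `e₀` survives only for a suitable `ψ K`.
    interpolate-feasible : ∀ {f c₁ c₂ c₃} {u v w : Vector (Point k) (k ℕ.+ m)} → OddStaircase f →
      Feasible c₁ u → Feasible c₂ v → (∀ i → Interpolant f (u i) (v i) (w i)) →
      (∀ e → Compat (c₃ e) (w (source e)) (w (target e))) → Feasible c₃ w
    interpolate-feasible {f} {u = u} {v} {w} S Fu Fv I C = record
      { compat   = C
      ; terminal = at-terminal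
      ; nonneg   = λ i → subst (0ℤ ≤_) (trans (ℤ.+-identityˡ _) (sym (hi+lo (I i))))
          (mix-≥0 S 0ℤ (hi (u i)) (up (ray (u i)) (v i)) (lo (u i)) (down (ray (u i)) (v i))
            (subst (0ℤ ≤_) (sym (ℤ.+-identityˡ _)) (nonneg Fu i))
            (subst (0ℤ ≤_) (trans (sym (up+down (ray (u i)) (v i))) (sym (ℤ.+-identityˡ _))) (nonneg Fv i)))
      ; within   = λ i → let ℓ = ray (w i) in
          subst (λ z → 0ℤ ≤ 2· M + z) (sym (cong₂ _-_ (lo-mix (I i)) (hi-mix (I i))))
            (mix-diff-≥0 S (2· M) (down ℓ (u i)) (down ℓ (v i)) (up ℓ (u i)) (up ℓ (v i))
              (spread ℓ (u i) (within Fu i)) (spread ℓ (v i) (within Fv i)))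
      }
      where
      spread : ∀ ℓ (q : Point k) → 0ℤ ≤ 2· M + (lo q - hi q) → 0ℤ ≤ 2· M + (down ℓ q - up ℓ q)
      spread ℓ q 0≤ = ℤ.≤-trans 0≤ (ℤ.+-monoʳ-≤ (2· M) (ℤ.+-mono-≤ (lo≤down ℓ q) (ℤ.neg-mono-≤ (up≤hi ℓ q))))
      at-terminal : ∀ s → ray (w (s ↑ˡ m)) ≡ s × hi (w (s ↑ˡ m)) ≡ + M × lo (w (s ↑ˡ m)) ≡ - + M
      at-terminal s with terminal Fu s | terminal Fv s
      ... | u-ray , u-hi , u-lo | v-ray , v-hi , v-lo = w-ray , w-hi , w-lo
        where
        i = s ↑ˡ m
        w-ray : ray (w i) ≡ s
        w-ray = [ (λ eq → trans eq u-ray) , (λ eq → trans eq v-ray) ]′ (on-line (I i))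
        u-on = on-ray (u i) (trans u-ray (sym w-ray))
        v-on = on-ray (v i) (trans v-ray (sym w-ray))
        w-hi : hi (w i) ≡ + M
        w-hi = trans (hi-mix (I i)) (trans (cong₂ (mix f) (trans (proj₁ u-on) u-hi) (trans (proj₁ v-on) v-hi)) (mix-self S (+ M)))
        w-lo : lo (w i) ≡ - + M
        w-lo = trans (lo-mix (I i)) (trans (cong₂ (mix f) (trans (proj₂ u-on) u-lo) (trans (proj₂ v-on) v-lo)) (mix-self S (- + M)))

  -- The finite neighbourhood of a point.

  offset : Fin 5 → ℤ
  offset 0F = - + 2
  offset 1F = - + 1
  offset 2F = + 0
  offset 3F = + 1
  offset 4F = + 2

  ψ-offset : ∀ K t → ∃[ a ] ψ K t ≡ offset a
  ψ-offset K t with ∣ψ∣≤2 K t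
  ... | _ , ℕ.z≤n                   , inj₁ eq = 2F , eq
  ... | _ , ℕ.s≤s ℕ.z≤n             , inj₁ eq = 3F , eq
  ... | _ , ℕ.s≤s (ℕ.s≤s ℕ.z≤n)   , inj₁ eq = 4F , eq
  ... | _ , ℕ.z≤n                   , inj₂ eq = 2F , eq
  ... | _ , ℕ.s≤s ℕ.z≤n             , inj₂ eq = 1F , eq
  ... | _ , ℕ.s≤s (ℕ.s≤s ℕ.z≤n)   , inj₂ eq = 0F , eq

  -- Measured along the ray of `w`, so that points across the centre from `u` are included.
  record Near {k} (u w : Point k) (a b : Fin 5) : Set where
    constructor near
    field
      hi-near : hi w ≡ up (ray w) u + offset a
      lo-near : lo w ≡ down (ray w) u + offset b

  -- The left side is twice the larger of the two absolute offsets. In doubled units, 4 means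
  -- distance 2.
  near-bound : ∀ a b → + ℤ.∣ offset b - offset a ∣ + + ℤ.∣ - (offset a + offset b) ∣ ≤ + 4
  near-bound = from-yes (Fin.all? λ a → Fin.all? λ b →
    + ℤ.∣ offset b - offset a ∣ + + ℤ.∣ - (offset a + offset b) ∣ ℤ.≤? + 4)

  near⇒dist₂ : ∀ {k} {u w : Point k} {a b} → Near u w a b →
    dist₂ u w + + ℤ.∣ (hi u + lo u) - (hi w + lo w) ∣ ≤ + 4
  near⇒dist₂ {u = u} {w} {a} {b} (near h l) with ray u Fin.≟ ray w
  ... | yes _ rewrite h | l = subst₂ (λ r s → + ℤ.∣ r ∣ + + ℤ.∣ s ∣ ≤ + 4)
    (radii (hi u) (lo u) (offset a) (offset b)) (heights (hi u) (lo u) (offset a) (offset b)) (near-bound a b)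
    where
    radii : ∀ h l a b → b - a ≡ (h - l) - (h + a - (l + b))
    radii = solve-∀
    heights : ∀ h l a b → - (a + b) ≡ h + l - (h + a + (l + b))
    heights = solve-∀
  ... | no _ rewrite h | l = subst₂ (λ r s → r + + ℤ.∣ s ∣ ≤ + 4)
    (radii (hi u) (lo u) (offset a) (offset b)) (heights (hi u) (lo u) (offset a) (offset b))
    (ℤ.≤-trans (ℤ.+-monoˡ-≤ (+ ℤ.∣ - (offset a + offset b) ∣)
                 (subst (offset a - offset b ≤_) (cong +_ (ℤ.∣i-j∣≡∣j-i∣ (offset a) (offset b))) (i≤∣i∣ (offset a - offset b))))
               (near-bound a b))
    where
    radii : ∀ h l a b → a - b ≡ (h - l) + (l + a - (h + b))
    radii = solve-∀
    heights : ∀ h l a b → - (a + b) ≡ h + l - (l + a + (h + b))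
    heights = solve-∀

  near⇒gridDist≤2 : ∀ {k} {u w : Point k} {g g′ a b} → Represents u g → Represents w g′ → Near u w a b →
    gridDist g g′ ℚ.≤ fromℕ 2
  near⇒gridDist≤2 {u = u} {w} {g} {g′} R R′ n = subst₂ ℚ._≤_ (sym eq) (half-double (+ 2)) (half-mono (near⇒dist₂ n))
    where
    eq : gridDist g g′ ≡ half (dist₂ u w + + ℤ.∣ (hi u + lo u) - (hi w + lo w) ∣)
    eq rewrite dist-half R R′ | y≡ R | y≡ R′ = sym
      (trans (half-+ (dist₂ u w) _) (cong (half (dist₂ u w) ℚ.+_)
        (trans (half-∣∣ _) (cong ℚ.∣_∣ (half-- (hi u + lo u) (hi w + lo w))))))

  interpolant-near : ∀ {k K} {u v w : Point k} → Interpolant (ψ K) u v w → ∃[ a ] ∃[ b ] Near u w a b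
  interpolant-near {K = K} {u} {v} {w} I = proj₁ α , proj₁ β , near
    (trans (hi-mix I) (cong (λ z → up (ray w) u + z) (proj₂ α)))
    (trans (lo-mix I) (cong (λ z → down (ray w) u + z) (proj₂ β)))
    where
    α = ψ-offset K (up (ray w) v - up (ray w) u)
    β = ψ-offset K (down (ray w) v - down (ray w) u)

  -- A leg and two offsets, coded as a number so that families of choices over all vertices are
  -- again numbered by some `Fin` and can be searched.
  Choice : ℕ → Set
  Choice k = Fin (k ℕ.* (5 ℕ.* 5))

  choose : ∀ {k} → Fin k → Fin 5 → Fin 5 → Choice k
  choose ℓ a b = combine ℓ (combine a b)

  unchoose : ∀ {k} → Choice k → Fin k × Fin 5 × Fin 5
  unchoose {k} c = proj₁ (remQuot {k} (5 ℕ.* 5) c) , remQuot {5} 5 (proj₂ (remQuot {k} (5 ℕ.* 5) c))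

  unchoose-choose : ∀ {k} (ℓ : Fin k) a b → unchoose (choose ℓ a b) ≡ (ℓ , a , b)
  unchoose-choose {k} ℓ a b = trans
    (cong (λ t → proj₁ t , remQuot {5} 5 (proj₂ t)) (Fin.remQuot-combine {k} ℓ (combine a b)))
    (cong (ℓ ,_) (Fin.remQuot-combine {5} a b))

  near-self : ∀ {k} (u : Point k) → Near u u 2F 2F
  near-self u = near (trans (sym (proj₁ (on-ray u refl))) (sym (ℤ.+-identityʳ _)))
                     (trans (sym (proj₂ (on-ray u refl))) (sym (ℤ.+-identityʳ _)))

  candidate : ∀ {k} → Point k → Fin k × Fin 5 × Fin 5 → Point k
  candidate u (ℓ , a , b) with (down ℓ u + offset b) ℤ.≤? (up ℓ u + offset a)
  ... | yes le = point ℓ _ _ le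
  -- Default for offsets that would put `lo` above `hi`: with `u` itself, every candidate stays near
  -- `u`.
  ... | no _   = u

  candidate-near : ∀ {k} (u : Point k) t → ∃[ a ] ∃[ b ] Near u (candidate u t) a b
  candidate-near u (ℓ , a , b) with (down ℓ u + offset b) ℤ.≤? (up ℓ u + offset a)
  ... | yes le = a , b , near refl refl
  ... | no _   = 2F , 2F , near-self u

  -- Together with `candidate-near`: the candidates are exactly the points near `u`.
  near-candidate : ∀ {k} {u w : Point k} {a b} → Near u w a b → candidate u (ray w , a , b) ≡ w
  near-candidate {u = u} {point ℓ _ _ lo≤hi} {a} {b} (near refl refl) with (down ℓ u + offset b) ℤ.≤? (up ℓ u + offset a)
  ... | yes le = cong (point ℓ _ _) (ℤ.≤-irrelevant le lo≤hi)
  ... | no nle = contradiction lo≤hi nle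

  foldr-⊔-≤ : ∀ {r n} (v : Vector ℚ n) → 0ℚ ℚ.≤ r → (∀ i → v i ℚ.≤ r) → foldr ℚ._⊔_ 0ℚ v ℚ.≤ r
  foldr-⊔-≤ {n = zero}  v 0≤r v≤r = 0≤r
  foldr-⊔-≤ {n = suc n} v 0≤r v≤r = ℚ.⊔-lub (v≤r zero) (foldr-⊔-≤ (v ∘ suc) 0≤r (v≤r ∘ suc))

  near⇒distance≤2 : ∀ {k n} {u w : Vector (Point k) n} {p q} →
    (∀ i → Represents (u i) (p i)) → (∀ i → Represents (w i) (q i)) →
    (∀ i → ∃[ a ] ∃[ b ] Near (u i) (w i) a b) → distance p q ℚ.≤ fromℕ 2
  near⇒distance≤2 {p = p} {q} R R′ n = foldr-⊔-≤ (λ i → gridDist (p i) (q i)) (ℚ.nonNegative⁻¹ (fromℕ 2))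
    (λ i → near⇒gridDist≤2 (R i) (R′ i) (proj₂ (proj₂ (n i))))

  -- The objective, and the exchange between two potentials.

  module _ {k m : ℕ} (N : Network k m) where

    open Network N using (capacity)

    cost : Vector (Grid k) (k ℕ.+ m) → ℚ
    cost p = sum (λ j → fromℕ (capacity j) ℚ.* y (p (k ↑ʳ j)))

    module _ {d : Cost N} {M : ℕ} where

      h-potential : ∀ {p} → IsPotential N d M p → h N d M p ≡ [ cost p ]
      h-potential {p} P = cong (λ b → if b then [ cost p ] else ⊤⁺) (dec-true (isPotential? N d M p) P)

      h-nonpotential : ∀ {p} → ¬ IsPotential N d M p → h N d M p ≡ ⊤⁺
      h-nonpotential {p} ¬P = cong (λ b → if b then [ cost p ] else ⊤⁺) (dec-false (isPotential? N d M p) ¬P)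

    cost-exchange : ∀ p q p′ q′ → (∀ i → y (p i) ℚ.+ y (q i) ≡ y (p′ i) ℚ.+ y (q′ i)) →
                    cost p ℚ.+ cost q ≡ cost p′ ℚ.+ cost q′
    cost-exchange p q p′ q′ eq = begin
      cost p ℚ.+ cost q                   ≡⟨ ∑-distrib-+ (term p) (term q) ⟨
      sum (λ j → term p j ℚ.+ term q j)   ≡⟨ sum-cong-≗ pointwise ⟩
      sum (λ j → term p′ j ℚ.+ term q′ j) ≡⟨ ∑-distrib-+ (term p′) (term q′) ⟩
      cost p′ ℚ.+ cost q′                 ∎
      where
      open ≡-Reasoning
      term : Vector (Grid k) (k ℕ.+ m) → Vector ℚ m
      term p j = fromℕ (capacity j) ℚ.* y (p (k ↑ʳ j))
      pointwise : ∀ j → term p j ℚ.+ term q j ≡ term p′ j ℚ.+ term q′ j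
      pointwise j = trans (sym (ℚ.*-distribˡ-+ (fromℕ (capacity j)) (y (p (k ↑ʳ j))) (y (q (k ↑ʳ j)))))
        (trans (cong (fromℕ (capacity j) ℚ.*_) (eq (k ↑ʳ j))) (ℚ.*-distribˡ-+ (fromℕ (capacity j)) (y (p′ (k ↑ʳ j))) (y (q′ (k ↑ʳ j)))))

    decreaseAt-cases : ∀ e₀ (d : Cost N) e → (e ≡ e₀ × decreaseAt e₀ d e ≡ d e ∸ 1) ⊎ decreaseAt e₀ d e ≡ d e
    decreaseAt-cases e₀ d e with e ≟ᴱ e₀
    ... | yes eq = inj₁ (eq , cong (λ b → if b then d e ∸ 1 else d e) (dec-true (e ≟ᴱ e₀) eq))
    ... | no neq = inj₂ (cong (λ b → if b then d e ∸ 1 else d e) (dec-false (e ≟ᴱ e₀) neq))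

    decreaseAt-≤ : ∀ e₀ (d : Cost N) e → decreaseAt e₀ d e ℕ.≤ d e
    decreaseAt-≤ e₀ d e with decreaseAt-cases e₀ d e
    ... | inj₁ (_ , eq) = subst (ℕ._≤ d e) (sym eq) (ℕ.m∸n≤m (d e) 1)
    ... | inj₂ eq       = ℕ.≤-reflexive eq

  compat-weaken : ∀ {k c c′} {w w′ : Point k} → c ≤ c′ → Compat c w w′ → Compat c′ w w′
  compat-weaken c≤c′ (same eq lh hl) =
    same eq (ℤ.≤-trans lh (ℤ.+-monoˡ-≤ _ c≤c′)) (ℤ.≤-trans hl (ℤ.+-monoˡ-≤ _ c≤c′))
  compat-weaken c≤c′ (diff neq ll) = diff neq (ℤ.≤-trans ll (ℤ.+-monoˡ-≤ _ c≤c′))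

  module _ {k m : ℕ} (N : Network k m) (M : ℕ) (d : Cost N) (e₀ : Edge N) (0<d : 0 ℕ.< d e₀)
           {u v : Vector (Point k) (k ℕ.+ m)}
           (Fu : Feasible N M (λ e → 2· d e) u) (Fv : Feasible N M (λ e → 2· decreaseAt e₀ d e) v) where

    private
      module Fu = Feasible Fu
      module Fv = Feasible Fv
      i₀ = source e₀
      j₀ = target e₀

    -- The staircases of `v′` and `u′` are complementary, which balances the heights. For `u′` the
    -- old costs suffice, and `v` satisfies them too because costs only decrease; for `v′` the
    -- choice of `K` protects the bound of `e₀`.
    exchange : ∃[ u′ ] ∃[ v′ ] Feasible N M (λ e → 2· d e) u′ × Feasible N M (λ e → 2· decreaseAt e₀ d e) v′
      × (∀ i → (hi (u i) + lo (u i)) + (hi (v i) + lo (v i)) ≡ (hi (u′ i) + lo (u′ i)) + (hi (v′ i) + lo (v′ i)))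
      × (∀ i → ∃[ a ] ∃[ b ] Near (u i) (v′ i) a b)
    exchange = u′ , v′ , Fu′ , Fv′ , balance , λ i → interpolant-near {K = K} (Iv i)
      where
      -- The constant is the decreased right-hand side of `e₀`; as `d e₀` is positive, the old one
      -- is larger by exactly 2.
      tight = steps-for-tight (2· (d e₀ ∸ 1)) (+≤+ ℕ.z≤n) (u i₀) (v i₀) (u j₀) (v j₀) (Fu.nonneg i₀) (Fu.nonneg j₀)
      K = proj₁ tight
      Ψ = ψ-staircase K
      Φ = complement Ψ
      v′ = λ i → proj₁ (interpolate Ψ (u i) (v i))
      Iv = λ i → proj₂ (interpolate Ψ (u i) (v i))
      u′ = λ i → proj₁ (interpolate Φ (u i) (v i))
      Iu = λ i → proj₂ (interpolate Φ (u i) (v i))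

      Fu′ : Feasible N M (λ e → 2· d e) u′
      Fu′ = interpolate-feasible N M Φ Fu Fv Iu λ e →
        compat-mix (λ {p} {q} {p′} {q′} _ _ → mix-≥0 Φ (2· d e) p q p′ q′) (Fu.compat e)
          (compat-weaken (+≤+ (ℕ.+-mono-≤ (decreaseAt-≤ N e₀ d e) (decreaseAt-≤ N e₀ d e))) (Fv.compat e))
          (Iu (source e)) (Iu (target e))

      2·-pred : ∀ {n} → 0 ℕ.< n → 2· n ≡ + 2 + 2· (n ∸ 1)
      2·-pred {suc n} _ = cong (λ z → + suc z) (ℕ.+-suc n n)

      compat-v′ : ∀ e → Compat (2· decreaseAt e₀ d e) (v′ (source e)) (v′ (target e))
      compat-v′ e with decreaseAt-cases N e₀ d e | Fv.compat e
      ... | inj₁ (refl , eq) | C rewrite eq =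
        compat-mix (proj₂ tight) (subst (λ c → Compat c (u i₀) (u j₀)) (2·-pred 0<d) (Fu.compat e₀)) C (Iv i₀) (Iv j₀)
      ... | inj₂ eq | C rewrite eq =
        -- The cost of `e` is unchanged here, so `u` and `v` satisfy the same bound.
        compat-mix (λ {p} {q} {p′} {q′} _ _ → mix-≥0 Ψ (2· d e) p q p′ q′) (Fu.compat e) C (Iv (source e)) (Iv (target e))

      Fv′ : Feasible N M (λ e → 2· decreaseAt e₀ d e) v′
      Fv′ = interpolate-feasible N M Ψ Fu Fv Iv compat-v′

      balance : ∀ i → (hi (u i) + lo (u i)) + (hi (v i) + lo (v i)) ≡ (hi (u′ i) + lo (u′ i)) + (hi (v′ i) + lo (v′ i))
      balance i = sym (begin
        (hi (u′ i) + lo (u′ i)) + (hi (v′ i) + lo (v′ i))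
          ≡⟨ cong₂ _+_ (hi+lo (Iu i)) (hi+lo (Iv i)) ⟩
        (mix φ (hi (u i)) V↑ + mix φ (lo (u i)) V↓) + (mix (ψ K) (hi (u i)) V↑ + mix (ψ K) (lo (u i)) V↓)
          ≡⟨ regroup (mix φ (hi (u i)) V↑) (mix φ (lo (u i)) V↓) (mix (ψ K) (hi (u i)) V↑) (mix (ψ K) (lo (u i)) V↓) ⟩
        (mix (ψ K) (hi (u i)) V↑ + mix φ (hi (u i)) V↑) + (mix (ψ K) (lo (u i)) V↓ + mix φ (lo (u i)) V↓)
          ≡⟨ cong₂ _+_ (mix-complement (ψ K) (hi (u i)) V↑) (mix-complement (ψ K) (lo (u i)) V↓) ⟩
        (hi (u i) + V↑) + (lo (u i) + V↓)
          ≡⟨ regroup′ (hi (u i)) V↑ (lo (u i)) V↓ ⟩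
        (hi (u i) + lo (u i)) + (V↑ + V↓)
          ≡⟨ cong (λ z → (hi (u i) + lo (u i)) + z) (up+down (ray (u i)) (v i)) ⟩
        (hi (u i) + lo (u i)) + (hi (v i) + lo (v i)) ∎)
        where
        open ≡-Reasoning
        φ = λ t → t - ψ K t
        V↑ = up (ray (u i)) (v i)
        V↓ = down (ray (u i)) (v i)
        regroup : ∀ a b c d → (a + b) + (c + d) ≡ (c + a) + (d + b)
        regroup = solve-∀
        regroup′ : ∀ a b c d → (a + b) + (c + d) ≡ (a + c) + (b + d)
        regroup′ = solve-∀

  -- From the finite neighbourhood to a global minimum.

  ≤⁺-totalOrder : TotalOrder _ _ _
  ≤⁺-totalOrder = record { isTotalOrder = ≤⁺-isTotalOrder-≡ ℚ.≤-isTotalOrder }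

  open TotalOrder ≤⁺-totalOrder using () renaming (trans to ≤⁺-transitive)

  argmin-Fin : ∀ {n} (f : Fin n → ℚ ⁺) → Fin n → ∃[ i ] ∀ j → f i ≤⁺ f j
  argmin-Fin f i₀ = Extrema.argmin ≤⁺-totalOrder f i₀ (allFin _) ,
    λ j → All.lookup (Extrema.f[argmin]≤f[xs] ≤⁺-totalOrder {f = f} i₀ (allFin _)) (∈-allFin j)

  module _ {k m : ℕ} (N : Network k m) (d : Cost N) (M : ℕ) (0<M : 0 ℕ.< M) (e₀ : Edge N) (0<d : 0 ℕ.< d e₀)
           (p : Vector (Grid k) (k ℕ.+ m)) (p-min : IsMinimizer (h N d M) p) where

    d₁ : Cost N
    d₁ = decreaseAt e₀ d

    potential-weaken : ∀ {q} → IsPotential N d₁ M q → IsPotential N d M q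
    potential-weaken P = record
      { IsPotential P
      ; edge-bound = λ e → ℚ.≤-trans (P.edge-bound e)
          (ℚ.*-monoˡ-≤-nonNeg (fromℕ 2) (fromℤ-mono (+≤+ (decreaseAt-≤ N e₀ d e))))
      }
      where module P = IsPotential P

    u : Vector (Point k) (k ℕ.+ m)
    u i = proj₁ (coordinates (p i))

    u-represents : ∀ i → Represents (u i) (p i)
    u-represents i = proj₂ (coordinates (p i))

    n = k ℕ.+ m

    choices : (Fin n → Fin k) → (Fin n → Fin 5) → (Fin n → Fin 5) → Fin ((k ℕ.* (5 ℕ.* 5)) ℕ.^ n)
    choices ℓ a b = funToFin (λ i → choose (ℓ i) (a i) (b i))

    point-at : Fin ((k ℕ.* (5 ℕ.* 5)) ℕ.^ n) → Vector (Point k) n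
    point-at c i = candidate (u i) (unchoose (finToFun c i))

    point-at-choices : ∀ {w : Vector (Point k) n} (nearby : ∀ i → ∃[ a ] ∃[ b ] Near (u i) (w i) a b) i →
      point-at (choices (λ i → ray (w i)) (λ i → proj₁ (nearby i)) (λ i → proj₁ (proj₂ (nearby i)))) i ≡ w i
    point-at-choices {w} nearby i = begin
      candidate (u i) (unchoose (finToFun (funToFin choice) i)) ≡⟨ cong (λ c → candidate (u i) (unchoose c)) (Fin.finToFun-funToFin choice i) ⟩
      candidate (u i) (unchoose (choice i))                     ≡⟨ cong (candidate (u i)) (unchoose-choose (ray (w i)) _ _) ⟩
      candidate (u i) (ray (w i) , _ , _)                       ≡⟨ near-candidate (proj₂ (proj₂ (nearby i))) ⟩
      w i                                                       ∎
      where
      open ≡-Reasoning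
      choice : Fin n → Choice k
      choice i = choose (ray (w i)) (proj₁ (nearby i)) (proj₁ (proj₂ (nearby i)))

    -- If the minimizer `p` has infinite value, then so has every point, while a potential for `d₁`
    -- would be one for `d`. In this degenerate case `p` itself also minimizes for `d₁`.
    no-potential : ¬ IsPotential N d M p → ∀ {r} → ¬ IsPotential N d₁ M r
    no-potential ¬P {r} Pr = ⊤⁺≰[] (subst₂ _≤⁺_ (h-nonpotential N ¬P) (h-potential N (potential-weaken Pr)) (p-min r))
      where
      ⊤⁺≰[] : ∀ {a} → ¬ (⊤⁺ ≤⁺ [ a ])
      ⊤⁺≰[] ()

    -- The exchange between `p` and `r` yields a candidate `v′`. By balance, its cost minus that of
    -- `r` equals the cost of `p` minus that of `u′`, which is at most 0 by minimality of `p`.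
    improve : IsPotential N d M p → ∀ r → IsPotential N d₁ M r →
              ∃[ c ] h N d₁ M (λ i → toGrid (point-at c i)) ≤⁺ h N d₁ M r
    improve P r Pr = c , subst₂ _≤⁺_ (sym (h-potential N Pv′)) (sym (h-potential N Pr)) [ cheaper ]
      where
      Rv = λ i → proj₂ (coordinates (r i))
      v = λ i → proj₁ (coordinates (r i))
      E = exchange N M d e₀ 0<d (feasible N M u-represents 0<M P) (feasible N M Rv 0<M Pr)
      u′ = proj₁ E
      v′ = proj₁ (proj₂ E)
      Fu′ = proj₁ (proj₂ (proj₂ E))
      Fv′ = proj₁ (proj₂ (proj₂ (proj₂ E)))
      balance = proj₁ (proj₂ (proj₂ (proj₂ (proj₂ E))))
      nearby = proj₂ (proj₂ (proj₂ (proj₂ (proj₂ E))))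
      c = choices (λ i → ray (v′ i)) (λ i → proj₁ (nearby i)) (λ i → proj₁ (proj₂ (nearby i)))
      q : Vector (Grid k) n
      q i = toGrid (point-at c i)
      c-represents : ∀ i → Represents (v′ i) (q i)
      c-represents i = subst (λ w → Represents w (q i)) (point-at-choices nearby i) (toGrid-represents (point-at c i))
      Pv′ : IsPotential N d₁ M q
      Pv′ = potential N M c-represents Fv′
      Pu′ : IsPotential N d M (toGrid ∘ u′)
      Pu′ = potential N M (λ i → toGrid-represents (u′ i)) Fu′
      u≤u′ : cost N p ℚ.≤ cost N (toGrid ∘ u′)
      u≤u′ = [≤]-injective (subst₂ _≤⁺_ (h-potential N P) (h-potential N Pu′) (p-min (toGrid ∘ u′)))
      y-balance : ∀ i → y (p i) ℚ.+ y (r i) ≡ y (toGrid (u′ i)) ℚ.+ y (q i)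
      y-balance i = begin
        y (p i) ℚ.+ y (r i)                                       ≡⟨ cong₂ ℚ._+_ (y≡ (u-represents i)) (y≡ (Rv i)) ⟩
        half (hi (u i) + lo (u i)) ℚ.+ half (hi (v i) + lo (v i)) ≡⟨ half-+ _ _ ⟨
        half ((hi (u i) + lo (u i)) + (hi (v i) + lo (v i)))      ≡⟨ cong half (balance i) ⟩
        half ((hi (u′ i) + lo (u′ i)) + (hi (v′ i) + lo (v′ i)))  ≡⟨ half-+ _ _ ⟩
        y (toGrid (u′ i)) ℚ.+ half (hi (v′ i) + lo (v′ i))        ≡⟨ cong (y (toGrid (u′ i)) ℚ.+_) (y≡ (c-represents i)) ⟨
        y (toGrid (u′ i)) ℚ.+ y (q i)                             ∎
        where open ≡-Reasoning
      cheaper : cost N q ℚ.≤ cost N r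
      cheaper = ℚ.≮⇒≥ λ r<q → ℚ.<-irrefl (cost-exchange N p r (toGrid ∘ u′) q y-balance) (ℚ.+-mono-≤-< u≤u′ r<q)

    minimizer-nearby : ∃[ q ] IsMinimizer (h N d₁ M) q × distance p q ℚ.≤ fromℕ 2
    minimizer-nearby = by-cases (isPotential? N d M p)
      where
      by-cases : Dec (IsPotential N d M p) → ∃[ q ] IsMinimizer (h N d₁ M) q × distance p q ℚ.≤ fromℕ 2
      by-cases (no ¬P) = p
        , (λ r → subst (h N d₁ M p ≤⁺_) (sym (h-nonpotential N (no-potential ¬P))) (_ ≤⊤⁺))
        , near⇒distance≤2 {u = u} u-represents u-represents (λ i → 2F , 2F , near-self (u i))
      by-cases (yes P) = q , (λ r → q-min r (isPotential? N d₁ M r))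
        , near⇒distance≤2 {u = u} {w = point-at (proj₁ minimum)} u-represents
            (λ i → toGrid-represents (point-at (proj₁ minimum) i))
            (λ i → candidate-near (u i) (unchoose (finToFun (proj₁ minimum) i)))
        where
        minimum = argmin-Fin (λ c → h N d₁ M (λ i → toGrid (point-at c i)))
                    -- `2F` codes the offset 0, so the search starts from `u` itself.
                    (choices (λ i → ray (u i)) (λ _ → 2F) (λ _ → 2F))
        q : Vector (Grid k) n
        q i = toGrid (point-at (proj₁ minimum) i)
        q-min : ∀ r → Dec (IsPotential N d₁ M r) → h N d₁ M q ≤⁺ h N d₁ M r
        q-min r (no ¬Pr) = subst (h N d₁ M q ≤⁺_) (sym (h-nonpotential N ¬Pr)) (_ ≤⊤⁺)
        q-min r (yes Pr) = ≤⁺-transitive (proj₂ minimum (proj₁ (improve P r Pr))) (proj₂ (improve P r Pr))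

open import Defs
open import Data.Nat using (ℕ; _+_; _<_) renaming (_≤_ to _≤ℕ_)
open import Data.Nat.Divisibility using (_∣_)
open import Data.Product using (∃-syntax; _×_)
open import Data.Rational using (_≤_)
open import Data.Vec.Functional using (Vector)

theorem3p12 : ∀ {k m : ℕ} → 3 ≤ℕ k →
    (N : Network k m) (d : Cost N) → (∀ e → 0 < d e) →
    (M : ℕ) → 0 < M →
    (e₀ : Edge N) → 2 ∣ d e₀ →
    (p : Vector (Grid k) (k + m)) → IsMinimizer (h N d M) p →
    ∃[ q ] IsMinimizer (h N (decreaseAt e₀ d) M) q × distance p q ≤ fromℕ 2
theorem3p12 _ N d 0<d M 0<M e₀ _ p p-min =
  HalfIntegralLattice.minimizer-nearby N d M 0<M e₀ (0<d e₀) p p-min
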